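{- (1) The formula $ADBDCDAD.DADCDBDA$ is avoided by $b_4$. (2) The formula $ABCDADC.CDADCBA$ is avoided by $z_3$. (3) The formula $ABACDBAC.CABDCABA$ is avoided by $z_3$ and by $b_4$.
   Context: A formula is a finite set of non-empty words over variables (fragments), written separated by dots. An occurrence of a formula $f$ in a word $w$ is a non-erasing morphism $h$ from variables to non-empty words such that $h(\phi)$ is a factor of $w$ for every fragment $\phi$; $w$ avoids $f$ if it has no occurrence. $b_4$ is the fixed point starting with $0$ of the morphism $0\mapsto 01,\ 1\mapsto 03,\ 2\mapsto 21,\ 3\mapsto 23$; $z_3$ is the fixed point starting with $0$ of the morphism $0\mapsto 01,\ 1\mapsto 2,\ 2\mapsto 20$. -}

module Defs where

open import Data.Nat using (ℕ; zero; suc; _+_)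
open import Data.Fin using (Fin; toℕ)
open import Data.List using (List; []; _∷_; concatMap; length; lookup)
open import Data.List.Relation.Unary.All using (All)
open import Data.Product using (Σ; ∃; _×_)
open import Relation.Binary.PropositionalEquality using (_≡_; _≢_)
open import Relation.Nullary using (¬_)

Word : Set → Set
Word A = ℕ → A

Factor : {A : Set} → List A → Word A → Set
Factor u w = ∃ λ i → (j : Fin (length u)) → w (i + toℕ j) ≡ lookup u j

-- A formula over k variables: a finite list of fragments (non-empty words over Fin k).
Formula : ℕ → Set
Formula k = List (List (Fin k))

image : {k : ℕ} {A : Set} → (Fin k → List A) → List (Fin k) → List A
image h φ = concatMap h φ

NonErasing : {k : ℕ} {A : Set} → (Fin k → List A) → Set
NonErasing {k} h = (x : Fin k) → h x ≢ []

Occurrence : {k : ℕ} {A : Set} → Formula k → Word A → (Fin k → List A) → Set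
Occurrence f w h = NonErasing h × All (λ φ → Factor (image h φ) w) f

Avoids : {k : ℕ} {A : Set} → Word A → Formula k → Set
Avoids {k} {A} w f = ¬ (Σ (Fin k → List A) λ h → Occurrence f w h)

iterate : {A : Set} → (A → List A) → ℕ → List A → List A
iterate σ zero u = u
iterate σ (suc n) u = iterate σ n (concatMap σ u)

at : {A : Set} → A → List A → ℕ → A
at d [] n = d
at d (x ∷ u) zero = x
at d (x ∷ u) (suc n) = at d u n

-- The fixed point starting with a of a morphism σ prolongable on a (σ(a) = a v, |σ^n(a)| → ∞):
-- letter n is the n-th letter of σ^(n+1)(a).  For b₄ and z₃, |σ^(n+1)(0)| > n, so the
-- default is never used, and σ^(n+1)(0) is a prefix of the fixed point.
fixedPoint : {A : Set} → (A → List A) → A → Word A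
fixedPoint σ a n = at a (iterate σ (suc n) (a ∷ [])) n

l0 l1 l2 l3 : Fin 4
l0 = Fin.zero
l1 = Fin.suc Fin.zero
l2 = Fin.suc (Fin.suc Fin.zero)
l3 = Fin.suc (Fin.suc (Fin.suc Fin.zero))

σb : Fin 4 → List (Fin 4)
σb Fin.zero = l0 ∷ l1 ∷ []
σb (Fin.suc Fin.zero) = l0 ∷ l3 ∷ []
σb (Fin.suc (Fin.suc Fin.zero)) = l2 ∷ l1 ∷ []
σb (Fin.suc (Fin.suc (Fin.suc Fin.zero))) = l2 ∷ l3 ∷ []

b₄ : Word (Fin 4)
b₄ = fixedPoint σb l0

m0 m1 m2 : Fin 3
m0 = Fin.zero
m1 = Fin.suc Fin.zero
m2 = Fin.suc (Fin.suc Fin.zero)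

σz : Fin 3 → List (Fin 3)
σz Fin.zero = m0 ∷ m1 ∷ []
σz (Fin.suc Fin.zero) = m2 ∷ []
σz (Fin.suc (Fin.suc Fin.zero)) = m2 ∷ m0 ∷ []

z₃ : Word (Fin 3)
z₃ = fixedPoint σz m0

A B C D : Fin 4
A = l0
B = l1
C = l2
D = l3

f₁ : Formula 4
f₁ = (A ∷ D ∷ B ∷ D ∷ C ∷ D ∷ A ∷ D ∷ [])
   ∷ (D ∷ A ∷ D ∷ C ∷ D ∷ B ∷ D ∷ A ∷ []) ∷ []

f₂ : Formula 4
f₂ = (A ∷ B ∷ C ∷ D ∷ A ∷ D ∷ C ∷ [])
   ∷ (C ∷ D ∷ A ∷ D ∷ C ∷ B ∷ A ∷ []) ∷ []

f₃ : Formula 4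
f₃ = (A ∷ B ∷ A ∷ C ∷ D ∷ B ∷ A ∷ C ∷ [])
   ∷ (C ∷ A ∷ B ∷ D ∷ C ∷ A ∷ B ∷ A ∷ []) ∷ []

{-# OPTIONS --safe #-}
-- Both words are fixed points of a morphism σ with recognisable images: a factor X of a word σ(y)
-- is either one of finitely many short words, or X = s σ(v) t with s, t from finite lists, cut in the
-- same way at each of its occurrences.  Call a formula in which letters may stand next to the variables
-- a pattern.  An occurrence of a pattern in σ(y) then yields an occurrence in y of one of finitely many
-- patterns, the words v being the new values of the variables and the gaps between them being decoded
-- uniquely.  A finite search through iterated desubstitutions shows that an occurrence of fᵢ always leads
-- to a contradiction, to an instance of fᵢ itself, or to an instance of a simpler formula excluded
-- beforehand (ACAC.CACA for z₃; AA, ABCA.ACBA, ABCAB.BACBA and ABACBA.ABCABA for b₄).  Since every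
-- factor of the fixed point lies in some σᵏ(0), induction on k finishes the proof.

module Submission where

open import Defs
open import Data.Bool using (Bool; true; false; _∧_; _∨_; not; if_then_else_; T)
open import Data.Bool.ListAction using (all; any)
open import Data.Bool.Properties using (T-∧; T-∨; T-≡)
open import Data.Empty using (⊥-elim)
open import Data.Fin using (Fin; zero; suc; toℕ)
open import Data.Fin.Properties using (toℕ<n)
open import Data.List using (List; []; _∷_; _++_; map; concat; concatMap; length; take; null; filterᵇ; cartesianProductWith; foldr; allFin; lookup)
open import Data.List.Properties using (++-assoc; ++-identityʳ; ++-conicalˡ; ++-conicalʳ; ∷-injective; ∷-injectiveˡ; ∷-injectiveʳ; concatMap-++; concatMap-map; length-++)
open import Data.List.Membership.Propositional using (_∈_; lose)
open import Data.List.Membership.Propositional.Properties using (∈-map⁺; ∈-++⁺ˡ; ∈-++⁺ʳ; ∈-filter⁺; ∈-cartesianProductWith⁺; ∈-allFin)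
open import Data.List.Relation.Unary.All as All using (All; []; _∷_)
open import Data.List.Relation.Unary.All.Properties as All using (all⁺; all⁻)
open import Data.List.Relation.Unary.Any as Any using (Any; here; there)
open import Data.List.Relation.Unary.Any.Properties as Any using (any⁺; any⁻)
open import Data.Maybe using (Maybe; just; nothing; fromMaybe)
open import Data.Nat using (ℕ; zero; suc; _+_; _∸_; _⊔_; _≤_; _<_; s≤s; z≤n)
open import Data.Nat.Properties using (+-identityʳ; +-suc; +-monoʳ-<; m+[n∸m]≡n; n≤1+n; n<1+n; m≤n⇒m≤n+o; <-trans; <⇒≤; m≤m⊔n; m≤n⊔m)
open import Data.Product using (∃; ∃₂; _×_; _,_; proj₁; proj₂)
open import Data.Sum using (_⊎_; inj₁; inj₂)
open import Data.Unit using (⊤; tt)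
open import Data.Vec as Vec using (Vec)
open import Function using (_∘_; Equivalence)
open import Relation.Binary.PropositionalEquality using (_≡_; _≢_; refl; sym; trans; cong; subst; module ≡-Reasoning)
open import Relation.Nullary using (¬_)

-- Boolean reflection and factors of finite words.

T-∧⁻ : ∀ {x y} → T (x ∧ y) → T x × T y
T-∧⁻ = Equivalence.to T-∧

T-∧⁺ : ∀ {x y} → T x → T y → T (x ∧ y)
T-∧⁺ p q = Equivalence.from T-∧ (p , q)

T-∨⁻ : ∀ {x y} → T (x ∨ y) → T x ⊎ T y
T-∨⁻ = Equivalence.to T-∨

T-not⁻ : ∀ {x} → T (not x) → ¬ T x
T-not⁻ {false} _ ()

not-null : ∀ {X : Set} {x : X} {xs} → x ∈ xs → T (not (null xs))
not-null (here _) = tt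
not-null (there _) = tt

if-true : ∀ {X : Set} {b} {x y : X} → T b → (if b then x else y) ≡ x
if-true {b = true} _ = refl

infix 4 _==_

_==_ : ∀ {m} → Fin m → Fin m → Bool
zero == zero = true
suc i == suc j = i == j
_ == _ = false

==-refl : ∀ {m} (i : Fin m) → T (i == i)
==-refl zero = tt
==-refl (suc i) = ==-refl i

==-sound : ∀ {m} {i j : Fin m} → T (i == j) → i ≡ j
==-sound {i = zero} {zero} _ = refl
==-sound {i = suc i} {suc j} p = cong suc (==-sound p)

infix 4 _⊑_

_⊑_ : {X : Set} → List X → List X → Set
u ⊑ w = ∃₂ λ l r → l ++ u ++ r ≡ w

⊑-refl : {X : Set} {u : List X} → u ⊑ u
⊑-refl {u = u} = [] , [] , ++-identityʳ u

⊑-trans : {X : Set} {u v w : List X} → u ⊑ v → v ⊑ w → u ⊑ w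
⊑-trans {u = u} (l , r , refl) (l′ , r′ , refl) = l′ ++ l , r ++ r′ , (begin
  (l′ ++ l) ++ u ++ r ++ r′   ≡⟨ ++-assoc l′ l _ ⟩
  l′ ++ l ++ u ++ r ++ r′     ≡⟨ cong (λ z → l′ ++ l ++ z) (++-assoc u r r′) ⟨
  l′ ++ l ++ (u ++ r) ++ r′   ≡⟨ cong (l′ ++_) (++-assoc l (u ++ r) r′) ⟨
  l′ ++ (l ++ u ++ r) ++ r′   ∎)
  where open ≡-Reasoning

concatMap-⊑ : {X Y : Set} (f : X → List Y) {u w : List X} → u ⊑ w → concatMap f u ⊑ concatMap f w
concatMap-⊑ f {u} (l , r , refl) = concatMap f l , concatMap f r , sym (begin
  concatMap f (l ++ u ++ r)                      ≡⟨ concatMap-++ f l (u ++ r) ⟩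
  concatMap f l ++ concatMap f (u ++ r)          ≡⟨ cong (concatMap f l ++_) (concatMap-++ f u r) ⟩
  concatMap f l ++ concatMap f u ++ concatMap f r ∎)
  where open ≡-Reasoning

++-∷-split : {X : Set} (xs : List X) {ys l : List X} {c : X} {r : List X} → l ++ c ∷ r ≡ xs ++ ys →
  (∃ λ r′ → xs ≡ l ++ c ∷ r′ × r ≡ r′ ++ ys) ⊎ (∃ λ l′ → l ≡ xs ++ l′ × l′ ++ c ∷ r ≡ ys)
++-∷-split [] {l = l} eq = inj₂ (l , refl , eq)
++-∷-split (x ∷ xs) {l = []} refl = inj₁ (xs , refl , refl)
++-∷-split (x ∷ xs) {l = y ∷ l} eq with ∷-injective eq
... | refl , eq′ with ++-∷-split xs eq′
... | inj₁ (r′ , refl , q) = inj₁ (r′ , refl , q)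
... | inj₂ (l′ , refl , q) = inj₂ (l′ , refl , q)

-- Windows: a set of allowed short factors preserved by the morphism.

-- A trie of words of a fixed length: `dead` has no continuation, `full` marks the end of a stored word,
-- so that `accepts` only looks at a window at the start of its argument.
data Trie (n : ℕ) : Set where
  dead full : Trie n
  node : Vec (Trie n) n → Trie n

module _ {n : ℕ} where

  insert : List (Fin n) → Trie n → Trie n
  insert [] _ = full
  insert (c ∷ u) (node ts) = node (Vec.updateAt ts c (insert u))
  insert (c ∷ u) _ = node (Vec.updateAt (Vec.replicate n dead) c (insert u))

  child : Trie n → Fin n → Trie n
  child dead c = dead
  child full c = full
  child (node ts) c = Vec.lookup ts c

  accepts : Trie n → List (Fin n) → Bool
  accepts dead u = false
  accepts full u = true
  accepts (node ts) [] = true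
  accepts (node ts) (c ∷ u) = accepts (Vec.lookup ts c) u

  -- Near the end of the word the remaining suffix is shorter than a window; it then only has to
  -- begin an allowed word.
  scan : Trie n → List (Fin n) → Bool
  scan t [] = true
  scan t (c ∷ u) = accepts t (c ∷ u) ∧ scan t u

  run : Trie n → List (Fin n) → Trie n
  run t [] = t
  run t (c ∷ u) = run (child t c) u

  accepts-child : ∀ t c u → T (accepts t (c ∷ u)) → T (accepts (child t c) u)
  accepts-child full c u p = tt
  accepts-child (node ts) c u p = p

  accepts-∷ : ∀ t c u → T (accepts (child t c) u) → T (accepts t (c ∷ u))
  accepts-∷ full c u p = tt
  accepts-∷ (node ts) c u p = p

  accepts-run : ∀ t w u → T (accepts (run t w) u) → T (accepts t (w ++ u))
  accepts-run t [] u p = p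
  accepts-run t (c ∷ w) u p = accepts-∷ t c (w ++ u) (accepts-run (child t c) w u p)

  accepts-prefix : ∀ t u w → T (accepts t (u ++ w)) → T (accepts t u)
  accepts-prefix full u w p = tt
  accepts-prefix (node ts) [] w p = tt
  accepts-prefix (node ts) (c ∷ u) w p = accepts-prefix (Vec.lookup ts c) u w p

  scan-suffix : ∀ t l {u} → T (scan t (l ++ u)) → T (scan t u)
  scan-suffix t [] p = p
  scan-suffix t (c ∷ l) p = scan-suffix t l (proj₂ (T-∧⁻ {accepts t (c ∷ l ++ _)} p))

  scan-prefix : ∀ t u {r} → T (scan t (u ++ r)) → T (scan t u)
  scan-prefix t [] p = tt
  scan-prefix t (c ∷ u) {r} p with T-∧⁻ {accepts t (c ∷ u ++ r)} p
  ... | p₁ , p₂ = T-∧⁺ (accepts-prefix t (c ∷ u) r p₁) (scan-prefix t u p₂)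

  scan-⊑ : ∀ t {u w} → u ⊑ w → T (scan t w) → T (scan t u)
  scan-⊑ t {u} (l , r , refl) p = scan-prefix t u (scan-suffix t l p)

  module _ (σ : Fin n → List (Fin n)) where

    -- If s accepts u then t accepts σ(u); this makes the window condition checkable on tries alone.
    simulates : Trie n → Trie n → Bool
    simulatesᵛ : ∀ {m} → (Fin m → Fin n) → Vec (Trie n) m → Trie n → Bool
    simulates dead t = true
    simulates full full = true
    simulates full _ = false
    simulates (node ss) dead = false
    simulates (node ss) t = simulatesᵛ (λ i → i) ss t
    simulatesᵛ ι Vec.[] t = true
    simulatesᵛ ι (s Vec.∷ ss) t = simulates s (run t (σ (ι zero))) ∧ simulatesᵛ (ι ∘ suc) ss t

    simulates-sound : ∀ s t u → T (simulates s t) → T (accepts s u) → T (accepts t (concatMap σ u))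
    simulates-lookup : ∀ {m} ι (ss : Vec (Trie n) m) t i → T (simulatesᵛ ι ss t) → T (simulates (Vec.lookup ss i) (run t (σ (ι i))))
    simulates-sound full full u _ _ = tt
    simulates-sound (node ss) full u _ _ = tt
    simulates-sound (node ss) (node ts) [] _ _ = tt
    simulates-sound (node ss) (node ts) (c ∷ u) p q =
      accepts-run (node ts) (σ c) _
        (simulates-sound (Vec.lookup ss c) (run (node ts) (σ c)) u (simulates-lookup (λ i → i) ss (node ts) c p) q)
    simulates-lookup ι (s Vec.∷ ss) t zero p = proj₁ (T-∧⁻ p)
    simulates-lookup ι (s Vec.∷ ss) t (suc i) p =
      simulates-lookup (ι ∘ suc) ss t i (proj₂ (T-∧⁻ {simulates s (run t (σ (ι zero)))} p))

    -- A window of σ(a u) that starts inside σ(a) reads a suffix of that block and then σ(u). If `t`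
    -- accepts a u, then `child t a` accepts u, so one simulation per suffix covers all starting
    -- positions.
    closedAt : Trie n → Fin n → List (Fin n) → Bool
    closedAt t a [] = true
    closedAt t a (c ∷ r) = simulates (child t a) (run t (c ∷ r)) ∧ closedAt t a r

    closed : Trie n → Bool
    closed t = all (λ a → closedAt t a (σ a)) (allFin n)

    scan-image : ∀ t → T (closed t) → ∀ y → T (scan t y) → T (scan t (concatMap σ y))
    scan-image t cl [] p = tt
    scan-image t cl (a ∷ y) p = go (σ a) (All.lookup (all⁺ _ (allFin n) cl) (∈-allFin a))
      where
      q = T-∧⁻ {accepts t (a ∷ y)} p
      go : ∀ s → T (closedAt t a s) → T (scan t (s ++ concatMap σ y))
      go [] _ = scan-image t cl y (proj₂ q)
      go (c ∷ s) h with T-∧⁻ {simulates (child t a) (run t (c ∷ s))} h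
      ... | h₁ , h₂ = T-∧⁺
        (accepts-run t (c ∷ s) _ (simulates-sound (child t a) (run t (c ∷ s)) y h₁ (accepts-child t a y (proj₁ q))))
        (go s h₂)

-- Patterns, their restriction to some variables, and matching with formulas.

data Item (n k : ℕ) : Set where
  lit : Fin n → Item n k
  var : Fin k → Item n k

Frag Pattern : ℕ → ℕ → Set
Frag n k = List (Item n k)
Pattern n k = List (Frag n k)

data Shape (n : ℕ) : Set where
  short : List (Fin n) → Shape n
  long  : List (Fin n) → List (Fin n) → Shape n

pattern-of : ∀ {n k} → Formula k → Pattern n k
pattern-of = map (map var)

choices : {X : Set} → List (List X) → List (List X)
choices [] = [] ∷ []
choices (xs ∷ xss) = cartesianProductWith _∷_ xs (choices xss)

update : ∀ {k} {X : Set} → (Fin k → X) → Fin k → X → Fin k → X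
update f x o y = if x == y then o else f y

module _ {n k : ℕ} where

  lits : List (Fin n) → Frag n k → Frag n k
  lits d φ = map lit d ++ φ

  -- The maximal runs free of variables outside p; the flag tells whether the current run ψ contains a
  -- variable, since runs of letters only carry no information.
  cut : (Fin k → Bool) → Frag n k → Bool → Frag n k → List (Frag n k)
  cut p ψ b [] = if b then ψ ∷ [] else []
  cut p ψ b (lit a ∷ φ) = cut p (ψ ++ lit a ∷ []) b φ
  cut p ψ b (var x ∷ φ) with p x
  ... | true = cut p (ψ ++ var x ∷ []) true φ
  ... | false = (if b then ψ ∷ [] else []) ++ cut p [] false φ

  -- A weakening: wherever P occurs, so do these factors of its fragments. They can be tested as
  -- soon as the variables in p have received shapes.
  restrict : (Fin k → Bool) → Pattern n k → Pattern n k
  restrict p = concatMap (cut p [] false)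

  insertVar : Fin k → List (Fin k) → List (Fin k)
  insertVar x [] = x ∷ []
  insertVar x (y ∷ xs) = if x == y then y ∷ xs else y ∷ insertVar x xs

  variables : Frag n k → List (Fin k) → List (Fin k)
  variables [] xs = xs
  variables (lit _ ∷ φ) xs = variables φ xs
  variables (var x ∷ φ) xs = variables φ (insertVar x xs)

  vars : Pattern n k → List (Fin k)
  vars P = variables (concat P) []

  covered : (Fin k → Bool) → Item n k → Bool
  covered p (lit _) = true
  covered p (var x) = p x

  eqItem : Item n k → Item n k → Bool
  eqItem (lit a) (lit b) = a == b
  eqItem (var x) (var y) = x == y
  eqItem _ _ = false

  prefix? : Frag n k → Frag n k → Bool
  prefix? [] ψ = true
  prefix? (i ∷ φ) [] = false
  prefix? (i ∷ φ) (j ∷ ψ) = eqItem i j ∧ prefix? φ ψ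

  infix? : Frag n k → Frag n k → Bool
  infix? φ [] = null φ
  infix? φ (j ∷ ψ) = prefix? φ (j ∷ ψ) ∨ infix? φ ψ

  Partial : Set
  Partial = Fin k → Maybe (Frag n k)

  -- The matching functions below need no correctness proof beyond this final test of the substitution θ.
  verify : Formula k → Pattern n k → (Fin k → Frag n k) → Bool
  verify Q P θ =
    all (λ x → not (null (θ x)) ∧ any (infix? (θ x)) P) (allFin k)
      ∧ all (λ φ → any (infix? (concatMap θ φ)) P) Q

  -- A variable absent from the formula stays unassigned by the matching, but must still receive a
  -- non-empty value that is a factor of the word; the first item of P provides one.
  total : Pattern n k → Partial → Fin k → Frag n k
  total P θ x = fromMaybe (take 1 (concat P)) (θ x)

  -- How many items a match may consume beyond one per variable.
  slack : List (Fin k) → Frag n k → Maybe ℕ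
  slack [] ψ = just (length ψ)
  slack (_ ∷ φ) [] = nothing
  slack (_ ∷ φ) (_ ∷ ψ) = slack φ ψ

  module _ (accept : Partial → Bool) where

    matchFrom : ℕ → List (Fin k) → Frag n k → Partial → Bool
    matchVar : ℕ → Fin k → Maybe (Frag n k) → List (Fin k) → Item n k → Frag n k → Partial → Bool
    strip : ℕ → Frag n k → List (Fin k) → Frag n k → Partial → Bool
    grow : ℕ → Fin k → List (Fin k) → Frag n k → Frag n k → Partial → Bool
    matchFrom s [] ψ θ = accept θ
    matchFrom s (x ∷ φ) [] θ = false
    matchFrom s (x ∷ φ) (i ∷ ψ) θ = matchVar s x (θ x) φ i ψ θ
    matchVar s x nothing φ i ψ θ = grow s x φ (i ∷ []) ψ θ
    matchVar s x (just []) φ i ψ θ = false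
    matchVar s x (just (j ∷ w)) φ i ψ θ = eqItem i j ∧ strip s w φ ψ θ
    strip s [] φ ψ θ = matchFrom s φ ψ θ
    strip (suc s) (j ∷ w) φ (i ∷ ψ) θ = eqItem i j ∧ strip s w φ ψ θ
    strip _ (j ∷ w) φ _ θ = false
    grow (suc s) x φ w (i ∷ ψ) θ =
      matchFrom (suc s) φ (i ∷ ψ) (update θ x (just w)) ∨ grow s x φ (w ++ i ∷ []) ψ θ
    grow s x φ w ψ θ = matchFrom s φ ψ (update θ x (just w))

    slide : ℕ → List (Fin k) → Frag n k → Partial → Bool
    slide (suc s) φ (i ∷ ψ) θ = matchFrom (suc s) φ (i ∷ ψ) θ ∨ slide s φ ψ θ
    slide s φ ψ θ = matchFrom s φ ψ θ

    matchIn : Maybe ℕ → List (Fin k) → Frag n k → Partial → Bool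
    matchIn nothing φ ψ θ = false
    matchIn (just s) φ ψ θ = slide s φ ψ θ

  matchAll : Formula k → Pattern n k → (Partial → Bool) → Partial → Bool
  matchAll [] P accept θ = accept θ
  matchAll (φ ∷ Q) P accept θ = any (λ ψ → matchIn (matchAll Q P accept) (slack φ ψ) φ ψ θ) P

  matches : Pattern n k → Formula k → Bool
  matches P Q = matchAll Q P (verify Q P ∘ total P) (λ _ → nothing)

-- Desubstitution and the finite search.

module Search {n : ℕ} (heads tails : Fin n → List (Fin n × List (Fin n))) (shapes : List (Shape n)) (t : Trie n) where

  -- `heads c` and `tails c` list the (a , r) such that c ∷ r is σ(a), respectively a suffix of σ(a).
  -- `parse m r u` decodes u, of which r is the rest of a block already begun; m = true allows u to stop
  -- inside a block.
  parse : Bool → List (Fin n) → List (Fin n) → List (List (Fin n))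
  branch : Bool → List (Fin n × List (Fin n)) → List (Fin n) → List (List (Fin n))
  parse m (c ∷ r) (d ∷ u) = if c == d then parse m r u else []
  parse m (c ∷ r) [] = if m then [] ∷ [] else []
  parse m [] [] = [] ∷ []
  parse m [] (d ∷ u) = branch m (heads d) u
  branch m [] u = []
  branch m ((a , r) ∷ hs) u = map (a ∷_) (parse m r u) ++ branch m hs u

  parseL : Bool → List (Fin n) → List (List (Fin n))
  parseL m [] = [] ∷ []
  parseL m (d ∷ u) = branch m (tails d) u

  -- A necessary condition on words of letters: the allowed windows must persist through j
  -- successive decodings, for some choice of preimages.
  deep : ℕ → List (Fin n) → Bool
  deep zero u = scan t u
  deep (suc j) u = scan t u ∧ any (deep j) (parseL true u)

  module _ {k : ℕ} where

    join : Fin k → List (List (Fin n)) → List (Frag n k) → List (Frag n k)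
    join x ds φs = cartesianProductWith (λ d φ → lits d (var x ∷ φ)) (filterᵇ (scan t) ds) φs

    -- u collects the letters read since the last block boundary known from a long variable; the flag is
    -- false as long as there was none, so that u may begin inside a block.
    desub : (Fin k → Shape n) → Bool → List (Fin n) → Frag n k → List (Frag n k)
    desubVar : (Fin k → Shape n) → Shape n → Bool → List (Fin n) → Fin k → Frag n k → List (Frag n k)
    desub f true u [] = map (λ d → lits d []) (filterᵇ (scan t) (parse true [] u))
    desub f false u [] = if deep 3 u then [] ∷ [] else []
    desub f b u (lit a ∷ φ) = desub f b (u ++ a ∷ []) φ
    desub f b u (var x ∷ φ) = desubVar f (f x) b u x φ
    desubVar f (short w) b u x φ = desub f b (u ++ w) φ
    desubVar f (long s r) true u x φ = join x (parse false [] (u ++ s)) (desub f true r φ)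
    desubVar f (long s r) false u x φ = join x (parseL false (u ++ s)) (desub f true r φ)

    feasible : (Fin k → Shape n) → Pattern n k → Bool
    feasible f = all (λ φ → not (null (desub f false [] φ)))

    -- Meant for patterns with a single variable, where a constant assignment of shapes loses no
    -- generality.
    stuck : Pattern n k → Bool
    stuck Q = all (λ o → not (feasible (λ _ → o) Q)) shapes

    -- Trying each variable alone first is what keeps the search small.
    closes : List (Formula k) → Pattern n k → Bool
    closes Λ P = any (λ x → stuck (restrict (x ==_) P)) (vars P) ∨ any (matches P) Λ

    -- The number bounds the nested desubstitutions. Shapes are assigned one variable at a time, so
    -- that an infeasible partial assignment prunes all its extensions.
    refute : List (Formula k) → ℕ → Pattern n k → Bool
    assign : List (Formula k) → ℕ → Pattern n k → List (Fin k × List (Shape n)) → (Fin k → Bool) → (Fin k → Shape n) → Bool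
    try : List (Formula k) → ℕ → Pattern n k → Fin k → List (Shape n) → List (Fin k × List (Shape n)) →
          (Fin k → Bool) → (Fin k → Shape n) → Pattern n k → Bool
    refute Λ zero P = false
    refute Λ (suc j) P =
      assign Λ j P (map (λ x → x , filterᵇ (λ o → feasible (λ _ → o) (restrict (x ==_) P)) shapes) (vars P))
        -- The default `short []` is never read: only variables already in p reach `desub`.
        (λ _ → false) (λ _ → short [])
    assign Λ j P [] p f =
      -- The first conjunct checks by computation that `vars` has listed every variable of P, which
      -- replaces a proof of that fact.
      all (all (covered p)) P ∧ all (λ P′ → closes Λ P′ ∨ refute Λ j P′) (choices (map (desub f false []) P))
    assign Λ j P ((x , os) ∷ xs) p f = try Λ j P x os xs (update p x true) f (restrict (update p x true) P)
    try Λ j P x [] xs p f Q = true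
    try Λ j P x (o ∷ os) xs p f Q =
      (not (feasible (update f x o) Q) ∨ assign Λ j P xs p (update f x o)) ∧ try Λ j P x os xs p f Q

-- Occurrences of patterns; soundness of matching and restriction.

module _ {n k : ℕ} where

  value : (Fin k → List (Fin n)) → Item n k → List (Fin n)
  value h (lit a) = a ∷ []
  value h (var x) = h x

  ⟦_⟧ : Frag n k → (Fin k → List (Fin n)) → List (Fin n)
  ⟦ φ ⟧ h = concatMap (value h) φ

  -- A variable may be missing from P, since desubstitution drops those with short values. That its
  -- value is a non-empty factor of y is therefore demanded separately; recognisability is applied
  -- to these factors.
  Occurs : List (Fin n) → Pattern n k → Set
  Occurs y P = ∃ λ h → (∀ x → h x ≢ [] × h x ⊑ y) × All (λ φ → ⟦ φ ⟧ h ⊑ y) P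

  Occurs-⊑ : ∀ {y z} {P : Pattern n k} → y ⊑ z → Occurs y P → Occurs z P
  Occurs-⊑ y⊑z (h , hs , ps) =
    h , (λ x → proj₁ (hs x) , ⊑-trans (proj₂ (hs x)) y⊑z) , All.map (λ p → ⊑-trans p y⊑z) ps

  ⟦lits⟧ : ∀ d φ h → ⟦ lits d φ ⟧ h ≡ d ++ ⟦ φ ⟧ h
  ⟦lits⟧ [] φ h = refl
  ⟦lits⟧ (a ∷ d) φ h = cong (a ∷_) (⟦lits⟧ d φ h)

  ⟦map-var⟧ : ∀ (θ : Fin k → Frag n k) h φ → ⟦ concatMap θ φ ⟧ h ≡ ⟦ map var φ ⟧ (λ x → ⟦ θ x ⟧ h)
  ⟦map-var⟧ θ h [] = refl
  ⟦map-var⟧ θ h (x ∷ φ) = trans (concatMap-++ (value h) (θ x) (concatMap θ φ)) (cong (⟦ θ x ⟧ h ++_) (⟦map-var⟧ θ h φ))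

  ⟦⟧-nonempty : ∀ {h} → (∀ x → h x ≢ []) → ∀ φ → T (not (null φ)) → ⟦ φ ⟧ h ≢ []
  ⟦⟧-nonempty hs (lit a ∷ φ) _ ()
  ⟦⟧-nonempty hs (var x ∷ φ) _ eq = hs x (++-conicalˡ _ _ eq)

  eqItem-sound : ∀ {i j : Item n k} → T (eqItem i j) → i ≡ j
  eqItem-sound {lit a} {lit b} p = cong lit (==-sound p)
  eqItem-sound {var x} {var y} p = cong var (==-sound p)

  prefix?-sound : ∀ (φ ψ : Frag n k) → T (prefix? φ ψ) → ∃ λ r → φ ++ r ≡ ψ
  prefix?-sound [] ψ p = ψ , refl
  prefix?-sound (i ∷ φ) (j ∷ ψ) p with T-∧⁻ {eqItem i j} p
  ... | p₁ , p₂ with eqItem-sound {i} {j} p₁ | prefix?-sound φ ψ p₂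
  ... | refl | r , refl = r , refl

  infix?-sound : ∀ (φ ψ : Frag n k) → T (infix? φ ψ) → φ ⊑ ψ
  infix?-sound [] [] p = [] , [] , refl
  infix?-sound φ (j ∷ ψ) p with T-∨⁻ {prefix? φ (j ∷ ψ)} p
  ... | inj₁ q with prefix?-sound φ (j ∷ ψ) q
  ...   | r , eq = [] , r , eq
  infix?-sound φ (j ∷ ψ) p | inj₂ q with infix?-sound φ ψ q
  ...   | l , r , refl = j ∷ l , r , refl

  any-infix?-sound : ∀ φ (P : Pattern n k) → T (any (infix? φ) P) → Any (φ ⊑_) P
  any-infix?-sound φ P p = Any.map (λ {ψ} → infix?-sound φ ψ) (any⁻ (infix? φ) P p)

  ⟦⟧-Any-⊑ : ∀ {h φ w} {P : Pattern n k} → All (λ ψ → ⟦ ψ ⟧ h ⊑ w) P → Any (φ ⊑_) P → ⟦ φ ⟧ h ⊑ w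
  ⟦⟧-Any-⊑ {h} (p ∷ ps) (here q) = ⊑-trans (concatMap-⊑ (value h) q) p
  ⟦⟧-Any-⊑ (p ∷ ps) (there q) = ⟦⟧-Any-⊑ ps q

  -- If h realises P, then substituting θ first and h afterwards realises Q.
  verify-sound : ∀ Q (P : Pattern n k) θ {y} → T (verify Q P θ) → Occurs y P → Occurs y (pattern-of Q)
  verify-sound Q P θ {y} p (h , hs , ps) = (λ x → ⟦ θ x ⟧ h) , var-ok , frags-ok Q (all⁺ _ Q (proj₂ q))
    where
    q = T-∧⁻ {all (λ x → not (null (θ x)) ∧ any (infix? (θ x)) P) (allFin k)} p
    var-ok : ∀ x → ⟦ θ x ⟧ h ≢ [] × ⟦ θ x ⟧ h ⊑ y
    var-ok x with T-∧⁻ {not (null (θ x))} (All.lookup (all⁺ _ (allFin k) (proj₁ q)) (∈-allFin x))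
    ... | r , s = ⟦⟧-nonempty (proj₁ ∘ hs) (θ x) r , ⟦⟧-Any-⊑ ps (any-infix?-sound (θ x) P s)
    frags-ok : ∀ Q → All (λ φ → T (any (infix? (concatMap θ φ)) P)) Q →
               All (λ φ → ⟦ φ ⟧ (λ x → ⟦ θ x ⟧ h) ⊑ y) (pattern-of Q)
    frags-ok [] [] = []
    frags-ok (φ ∷ Q) (r ∷ rs) =
      subst (_⊑ y) (⟦map-var⟧ θ h φ) (⟦⟧-Any-⊑ ps (any-infix?-sound _ P r)) ∷ frags-ok Q rs

  module _ (accept : Partial {n} {k} → Bool) where

    matchFrom-sound : ∀ s φ ψ θ → T (matchFrom accept s φ ψ θ) → ∃ λ θ′ → T (accept θ′)
    matchVar-sound : ∀ s x m φ i ψ θ → T (matchVar accept s x m φ i ψ θ) → ∃ λ θ′ → T (accept θ′)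
    strip-sound : ∀ s w φ ψ θ → T (strip accept s w φ ψ θ) → ∃ λ θ′ → T (accept θ′)
    grow-sound : ∀ s x φ w ψ θ → T (grow accept s x φ w ψ θ) → ∃ λ θ′ → T (accept θ′)
    matchFrom-sound s [] ψ θ p = θ , p
    matchFrom-sound s (x ∷ φ) (i ∷ ψ) θ p = matchVar-sound s x (θ x) φ i ψ θ p
    matchVar-sound s x nothing φ i ψ θ p = grow-sound s x φ (i ∷ []) ψ θ p
    matchVar-sound s x (just (j ∷ w)) φ i ψ θ p = strip-sound s w φ ψ θ (proj₂ (T-∧⁻ {eqItem i j} p))
    strip-sound zero [] φ ψ θ p = matchFrom-sound zero φ ψ θ p
    strip-sound (suc s) [] φ ψ θ p = matchFrom-sound (suc s) φ ψ θ p
    strip-sound (suc s) (j ∷ w) φ (i ∷ ψ) θ p = strip-sound s w φ ψ θ (proj₂ (T-∧⁻ {eqItem i j} p))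
    grow-sound zero x φ w ψ θ p = matchFrom-sound zero φ ψ (update θ x (just w)) p
    grow-sound (suc s) x φ w [] θ p = matchFrom-sound (suc s) φ [] (update θ x (just w)) p
    grow-sound (suc s) x φ w (i ∷ ψ) θ p
      with T-∨⁻ {matchFrom accept (suc s) φ (i ∷ ψ) (update θ x (just w))} p
    ... | inj₁ q = matchFrom-sound (suc s) φ (i ∷ ψ) (update θ x (just w)) q
    ... | inj₂ q = grow-sound s x φ (w ++ i ∷ []) ψ θ q

    slide-sound : ∀ s φ ψ θ → T (slide accept s φ ψ θ) → ∃ λ θ′ → T (accept θ′)
    slide-sound zero φ ψ θ p = matchFrom-sound zero φ ψ θ p
    slide-sound (suc s) φ [] θ p = matchFrom-sound (suc s) φ [] θ p
    slide-sound (suc s) φ (i ∷ ψ) θ p with T-∨⁻ {matchFrom accept (suc s) φ (i ∷ ψ) θ} p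
    ... | inj₁ q = matchFrom-sound (suc s) φ (i ∷ ψ) θ q
    ... | inj₂ q = slide-sound s φ ψ θ q

    matchIn-sound : ∀ m φ ψ θ → T (matchIn accept m φ ψ θ) → ∃ λ θ′ → T (accept θ′)
    matchIn-sound (just s) φ ψ θ p = slide-sound s φ ψ θ p

  matchAll-sound : ∀ Q (P : Pattern n k) accept θ → T (matchAll Q P accept θ) → ∃ λ θ′ → T (accept θ′)
  matchAll-sound [] P accept θ p = θ , p
  matchAll-sound (φ ∷ Q) P accept θ p
    with Any.satisfied (any⁻ (λ ψ → matchIn (matchAll Q P accept) (slack φ ψ) φ ψ θ) P p)
  ... | ψ , q with matchIn-sound (matchAll Q P accept) (slack φ ψ) φ ψ θ q
  ... | θ′ , r = matchAll-sound Q P accept θ′ r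

  matches-sound : ∀ Q (P : Pattern n k) {y} → T (matches P Q) → Occurs y P → Occurs y (pattern-of Q)
  matches-sound Q P p with matchAll-sound Q P (verify Q P ∘ total P) (λ _ → nothing) p
  ... | θ , q = verify-sound Q P (total P θ) q

  Covered : (Fin k → Bool) → Frag n k → Set
  Covered p = All (T ∘ covered p)

  cut-sound : ∀ p ψ b (φ : Frag n k) → Covered p ψ → All (λ ρ → ρ ⊑ ψ ++ φ × Covered p ρ) (cut p ψ b φ)
  cut-sound p ψ true [] c = (subst (ψ ⊑_) (sym (++-identityʳ ψ)) ⊑-refl , c) ∷ []
  cut-sound p ψ false [] c = []
  cut-sound p ψ b (lit a ∷ φ) c =
    subst (λ χ → All (λ ρ → ρ ⊑ χ × Covered p ρ) (cut p (ψ ++ lit a ∷ []) b φ)) (++-assoc ψ _ φ)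
      (cut-sound p (ψ ++ lit a ∷ []) b φ (All.++⁺ c (tt ∷ [])))
  cut-sound p ψ b (var x ∷ φ) c with p x in eq
  ... | true = subst (λ χ → All (λ ρ → ρ ⊑ χ × Covered p ρ) (cut p (ψ ++ var x ∷ []) true φ)) (++-assoc ψ _ φ)
      (cut-sound p (ψ ++ var x ∷ []) true φ (All.++⁺ c (Equivalence.from T-≡ eq ∷ [])))
  ... | false = All.++⁺ (head b)
      (All.map (λ (q , d) → ⊑-trans q (ψ ++ var x ∷ [] , [] , trans (++-assoc ψ _ _) (cong (λ z → ψ ++ var x ∷ z) (++-identityʳ φ))) , d)
        (cut-sound p [] false φ []))
    where
    head : ∀ b → All (λ ρ → ρ ⊑ ψ ++ var x ∷ φ × Covered p ρ) (if b then ψ ∷ [] else [])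
    head true = (([] , var x ∷ φ , refl) , c) ∷ []
    head false = []

  restrict-sound : ∀ p {h w} (P : Pattern n k) → All (λ φ → ⟦ φ ⟧ h ⊑ w) P →
    All (λ ρ → ⟦ ρ ⟧ h ⊑ w × Covered p ρ) (restrict p P)
  restrict-sound p [] [] = []
  restrict-sound p {h} (φ ∷ P) (q ∷ qs) =
    All.++⁺ (All.map (λ (r , c) → ⊑-trans (concatMap-⊑ (value h) r) q , c) (cut-sound p [] false φ []))
      (restrict-sound p P qs)

choices-complete : {X Y : Set} {R : Y → Set} {f : X → List Y} (xs : List X) →
  All (λ x → ∃ λ y → y ∈ f x × R y) xs → ∃ λ ys → ys ∈ choices (map f xs) × All R ys
choices-complete [] [] = [] , here refl , []
choices-complete (x ∷ xs) ((y , y∈ , r) ∷ ps) with choices-complete xs ps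
... | ys , ys∈ , rs = y ∷ ys , ∈-cartesianProductWith⁺ _∷_ y∈ ys∈ , r ∷ rs

-- Recognisability of images.

module _ {n : ℕ} (σ : Fin n → List (Fin n)) where

  -- At every occurrence, X = s σ(v) t with v in place between block boundaries.
  Aligned : (s t X v : List (Fin n)) → Set
  Aligned s t X v = ∀ L R y → L ++ X ++ R ≡ concatMap σ y →
    ∃₂ λ y₁ y₂ → y₁ ++ v ++ y₂ ≡ y × L ++ s ≡ concatMap σ y₁ × t ++ R ≡ concatMap σ y₂

  -- A short value vanishes from the desubstituted pattern, so v is arbitrary in that case. For a
  -- long one v becomes the new value, whence v must be non-empty.
  data Form : Shape n → List (Fin n) → List (Fin n) → Set where
    isShort : ∀ {w v} → Form (short w) w v
    isLong  : ∀ {s t X v} → v ≢ [] → Aligned s t X v → Form (long s t) X v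

  Recognisable : List (Shape n) → Set
  Recognisable shapes = ∀ X y → X ≢ [] → X ⊑ concatMap σ y → ∃₂ λ o v → o ∈ shapes × Form o X v

  -- Passing over whole blocks leads to the block σ(a) = l c r that contains the letter c following
  -- L.
  locate : ∀ y L {c w} → L ++ c ∷ w ≡ concatMap σ y →
    ∃₂ λ y₀ y₁ → ∃₂ λ l r → ∃ λ a →
      y₀ ++ a ∷ y₁ ≡ y × σ a ≡ l ++ c ∷ r × L ≡ concatMap σ y₀ ++ l × w ≡ r ++ concatMap σ y₁
  locate [] [] ()
  locate [] (_ ∷ _) ()
  locate (a ∷ y) L eq with ++-∷-split (σ a) eq
  ... | inj₁ (r , e , q) = [] , y , L , r , a , refl , e , refl , q
  ... | inj₂ (L′ , refl , q) with locate y L′ q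
  ...   | y₀ , y₁ , l , r , b , refl , e , refl , q′ =
    a ∷ y₀ , y₁ , l , r , b , refl , e , sym (++-assoc (σ a) (concatMap σ y₀) l) , q′

-- Soundness of the search: no actual occurrence is overlooked.

module Soundness {n : ℕ} (σ : Fin n → List (Fin n))
  (heads tails : Fin n → List (Fin n × List (Fin n)))
  (shapes : List (Shape n)) (t : Trie n)
  (nonerasing : ∀ a → σ a ≢ [])
  (heads-complete : ∀ {a c r} → σ a ≡ c ∷ r → (a , r) ∈ heads c)
  (tails-complete : ∀ {a c r} l → σ a ≡ l ++ c ∷ r → (a , r) ∈ tails c)
  (recognisable : Recognisable σ shapes)
  where

  σ* : List (Fin n) → List (Fin n)
  σ* = concatMap σ

  open Search heads tails shapes t

  branch-∈ : ∀ {m u a r d hs} → (a , r) ∈ hs → d ∈ parse m r u → a ∷ d ∈ branch m hs u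
  branch-∈ (here refl) q = ∈-++⁺ˡ (∈-map⁺ _ q)
  branch-∈ {m} {u} (there {x = b , s} p) q = ∈-++⁺ʳ (map (b ∷_) (parse m s u)) (branch-∈ p q)

  -- Only completeness matters for decoding: spurious preimages enlarge the search but cannot make a
  -- refutation wrong.
  parse-exact : ∀ r u y → r ++ σ* y ≡ u → y ∈ parse false r u
  parse-exact (c ∷ r) (d ∷ u) y eq with ∷-injective eq
  ... | refl , eq′ = subst (y ∈_) (sym (if-true (==-refl c))) (parse-exact r u y eq′)
  parse-exact [] [] [] eq = here refl
  parse-exact [] [] (a ∷ y) eq = ⊥-elim (nonerasing a (++-conicalˡ _ _ eq))
  parse-exact [] (d ∷ u) (a ∷ y) eq with σ a in e
  ... | [] = ⊥-elim (nonerasing a e)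
  ... | c ∷ r with ∷-injective eq
  ...   | refl , eq′ = branch-∈ (heads-complete e) (parse-exact r u y eq′)

  -- When u stops inside a block, d still contains the letter of that block, as `branch` records a
  -- letter on entering its block.
  parse-partial : ∀ r u R y → r ++ σ* y ≡ u ++ R → ∃₂ λ d y′ → d ∈ parse true r u × d ++ y′ ≡ y
  parse-partial (c ∷ r) (d ∷ u) R y eq with ∷-injective eq
  ... | refl , eq′ with parse-partial r u R y eq′
  ...   | d , y′ , p , q = d , y′ , subst (d ∈_) (sym (if-true (==-refl c))) p , q
  parse-partial (c ∷ r) [] R y eq = [] , y , here refl , refl
  parse-partial [] [] R y eq = [] , y , here refl , refl
  parse-partial [] (d ∷ u) R (a ∷ y) eq with σ a in e
  ... | [] = ⊥-elim (nonerasing a e)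
  ... | c ∷ r with ∷-injective eq
  ...   | refl , eq′ with parse-partial r u R y eq′
  ...     | d , y′ , p , refl = a ∷ d , y′ , branch-∈ (heads-complete e) p , refl

  parseL-exact : ∀ L u y → L ++ u ≡ σ* y → ∃₂ λ y₀ d → d ∈ parseL false u × y₀ ++ d ≡ y
  parseL-exact L [] y eq = y , [] , here refl , ++-identityʳ y
  parseL-exact L (c ∷ u) y eq with locate σ y L eq
  ... | y₀ , y₁ , l , r , a , refl , e , _ , q =
    y₀ , a ∷ y₁ , branch-∈ (tails-complete l e) (parse-exact r u y₁ (sym q)) , refl

  parseL-partial : ∀ u y → u ⊑ σ* y → ∃ λ d → d ∈ parseL true u × d ⊑ y
  parseL-partial [] y _ = [] , here refl , [] , y , refl
  parseL-partial (c ∷ u) y (L , R , eq) with locate σ y L eq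
  ... | y₀ , y₁ , l , r , a , refl , e , _ , q with parse-partial r u R y₁ (sym q)
  ...   | d , y′ , p , refl = a ∷ d , branch-∈ (tails-complete l e) p , y₀ , y′ , refl

  module _ {k : ℕ} (f : Fin k → Shape n) (h v : Fin k → List (Fin n)) where

    Fits : Item n k → Set
    Fits (lit _) = ⊤
    Fits (var x) = Form σ (f x) (h x) (v x)

    ∈-join : ∀ {x : Fin k} {d φ ds φs} → T (scan t d) → d ∈ ds → φ ∈ φs → lits d (var x ∷ φ) ∈ join x ds φs
    ∈-join g p q = ∈-cartesianProductWith⁺ (λ d φ → lits d (var _ ∷ φ)) (∈-filter⁺ _ p g) q

    assoc₃ : (u w : List (Fin n)) {z R : List (Fin n)} → u ++ (w ++ z) ++ R ≡ (u ++ w) ++ z ++ R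
    assoc₃ u w {z} {R} = trans (cong (u ++_) (++-assoc w z R)) (sym (++-assoc u w (z ++ R)))

    -- Here u starts at a block boundary, hence the decoded fragment yields a prefix of y.
    desub-cut : ∀ φ → All Fits φ → ∀ u R y → T (scan t y) → u ++ ⟦ φ ⟧ h ++ R ≡ σ* y →
      ∃₂ λ φ′ y′ → φ′ ∈ desub f true u φ × ⟦ φ′ ⟧ v ++ y′ ≡ y
    desubVar-cut : ∀ o x φ → Form σ o (h x) (v x) → All Fits φ → ∀ u R y → T (scan t y) →
      u ++ (h x ++ ⟦ φ ⟧ h) ++ R ≡ σ* y → ∃₂ λ φ′ y′ → φ′ ∈ desubVar f o true u x φ × ⟦ φ′ ⟧ v ++ y′ ≡ y
    desub-cut [] [] u R y g eq with parse-partial [] u R y (sym eq)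
    ... | d , y′ , p , refl = lits d [] , y′ ,
      ∈-map⁺ (λ d → lits d []) (∈-filter⁺ _ p (scan-prefix t d g)) ,
      cong (_++ y′) (trans (⟦lits⟧ d [] v) (++-identityʳ d))
    desub-cut (lit a ∷ φ) (_ ∷ fs) u R y g eq = desub-cut φ fs (u ++ a ∷ []) R y g (trans (++-assoc u _ _) eq)
    desub-cut (var x ∷ φ) (o ∷ fs) u R y g eq = desubVar-cut (f x) x φ o fs u R y g eq
    desubVar-cut (short w) x φ isShort fs u R y g eq =
      desub-cut φ fs (u ++ w) R y g (trans (sym (assoc₃ u w)) eq)
    desubVar-cut (long s r) x φ (isLong _ al) fs u R y g eq
      -- Alignment gives block boundaries on both sides of the copy of σ(v x): the gap u s is
      -- exactly σ(m), and r opens the next gap.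
      with al u (⟦ φ ⟧ h ++ R) y (trans (cong (u ++_) (sym (++-assoc (h x) _ R))) eq)
    ... | m , y₂ , refl , q₁ , q₂ with desub-cut φ fs r R y₂ (scan-suffix t (v x) (scan-suffix t m g)) q₂
    ...   | φ′ , y′ , p , refl = lits m (var x ∷ φ′) , y′ ,
      ∈-join (scan-prefix t m g) (parse-exact [] (u ++ s) m (sym q₁)) p ,
      trans (cong (_++ y′) (⟦lits⟧ m _ v)) (trans (++-assoc m _ y′) (cong (m ++_) (++-assoc (v x) _ y′)))

    module _ (z : List (Fin n)) (deep-ok : ∀ u → u ⊑ σ* z → T (deep 3 u)) (g : T (scan t z)) where

      -- No boundary is known yet and u may start inside a block. The first long variable supplies a
      -- boundary, from which `desub-cut` continues.
      desub-start : ∀ φ → All Fits φ → ∀ L u R → L ++ u ++ ⟦ φ ⟧ h ++ R ≡ σ* z →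
        ∃ λ φ′ → φ′ ∈ desub f false u φ × ⟦ φ′ ⟧ v ⊑ z
      desubVar-start : ∀ o x φ → Form σ o (h x) (v x) → All Fits φ → ∀ L u R →
        L ++ u ++ (h x ++ ⟦ φ ⟧ h) ++ R ≡ σ* z → ∃ λ φ′ → φ′ ∈ desubVar f o false u x φ × ⟦ φ′ ⟧ v ⊑ z
      -- Without a long variable the fragment has become a word of letters; once that word passes
      -- `deep`, only the empty fragment is kept, and it occurs everywhere.
      desub-start [] [] L u R eq =
        [] , subst ([] ∈_) (sym (if-true (deep-ok u (L , R , eq)))) (here refl) , [] , z , refl
      desub-start (lit a ∷ φ) (_ ∷ fs) L u R eq =
        desub-start φ fs L (u ++ a ∷ []) R (trans (cong (L ++_) (++-assoc u _ _)) eq)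
      desub-start (var x ∷ φ) (o ∷ fs) L u R eq = desubVar-start (f x) x φ o fs L u R eq
      desubVar-start (short w) x φ isShort fs L u R eq =
        desub-start φ fs L (u ++ w) R (trans (cong (L ++_) (sym (assoc₃ u w))) eq)
      desubVar-start (long s r) x φ (isLong _ al) fs L u R eq
        with al (L ++ u) (⟦ φ ⟧ h ++ R) z
               (trans (++-assoc L u _) (trans (cong (λ w → L ++ u ++ w) (sym (++-assoc (h x) _ R))) eq))
      ... | y₁ , y₂ , refl , q₁ , q₂
        with parseL-exact L (u ++ s) y₁ (trans (sym (++-assoc L u s)) q₁)
           | desub-cut φ fs r R y₂ (scan-suffix t (v x) (scan-suffix t y₁ g)) q₂
      ...   | y₀ , d , p , refl | φ′ , y′ , p′ , refl =
        lits d (var x ∷ φ′) ,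
        ∈-join (scan-suffix t y₀ (scan-prefix t (y₀ ++ d) g)) p p′ ,
        y₀ , y′ ,
        (begin
          y₀ ++ ⟦ lits d (var x ∷ φ′) ⟧ v ++ y′       ≡⟨ cong (λ w → y₀ ++ w ++ y′) (⟦lits⟧ d _ v) ⟩
          y₀ ++ (d ++ v x ++ ⟦ φ′ ⟧ v) ++ y′          ≡⟨ cong (y₀ ++_) (++-assoc d _ y′) ⟩
          y₀ ++ d ++ (v x ++ ⟦ φ′ ⟧ v) ++ y′          ≡⟨ cong (λ w → y₀ ++ d ++ w) (++-assoc (v x) _ y′) ⟩
          y₀ ++ d ++ v x ++ ⟦ φ′ ⟧ v ++ y′            ≡⟨ ++-assoc y₀ d _ ⟨
          (y₀ ++ d) ++ v x ++ ⟦ φ′ ⟧ v ++ y′          ∎)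
        where open ≡-Reasoning

  module _ (y : List (Fin n)) (good : T (scan t (σ* y))) (embed : y ⊑ σ* y) where

    -- Since y is a factor of σ(y), the decoded word is again a factor of σ(y), so decoding can be
    -- repeated any number of times.
    deep-sound : ∀ j u → u ⊑ σ* y → T (deep j u)
    deep-sound zero u p = scan-⊑ t p good
    deep-sound (suc j) u p with parseL-partial u y p
    ... | d , d∈ , q =
      T-∧⁺ (scan-⊑ t p good) (any⁺ (deep j) (lose d∈ (deep-sound j d (⊑-trans q embed))))

    -- For a long shape, alignment exhibits v inside y. For a short one any letter of y serves as
    -- the new value.
    choose : ∀ {X} → X ≢ [] → X ⊑ σ* y → ∃₂ λ o v → o ∈ shapes × Form σ o X v × v ≢ [] × v ⊑ y
    choose X≢[] X⊑ with recognisable _ y X≢[] X⊑ | X⊑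
    ... | o , v , o∈ , isLong v≢[] al | L , R , eq with al L R y eq
    ...   | y₁ , y₂ , q , _ = o , v , o∈ , isLong v≢[] al , v≢[] , y₁ , y₂ , q
    choose {X} X≢[] X⊑ | o , v , o∈ , isShort | L , R , eq with letter y eq
      where
      letter : ∀ z → L ++ X ++ R ≡ σ* z → ∃ λ v → v ≢ [] × v ⊑ z
      letter [] e = ⊥-elim (X≢[] (++-conicalˡ _ R (++-conicalʳ L _ e)))
      letter (a ∷ z) _ = a ∷ [] , (λ ()) , [] , z , refl
    ... | v′ , p = o , v′ , o∈ , isShort , p

    module Step {k : ℕ} {P : Pattern n k} (occ : Occurs (σ* y) P) where

      h v : Fin k → List (Fin n)
      o : Fin k → Shape n
      h = proj₁ occ
      choice = λ x → choose (proj₁ (proj₁ (proj₂ occ) x)) (proj₂ (proj₁ (proj₂ occ) x))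
      o = proj₁ ∘ choice
      v = proj₁ ∘ proj₂ ∘ choice

      Agrees : (Fin k → Bool) → (Fin k → Shape n) → Set
      Agrees p f = ∀ x → T (p x) → f x ≡ o x

      desub-sound : ∀ {p f} → Agrees p f → ∀ φ → Covered p φ → ⟦ φ ⟧ h ⊑ σ* y →
        ∃ λ φ′ → φ′ ∈ desub f false [] φ × ⟦ φ′ ⟧ v ⊑ y
      desub-sound {p} {f} ag φ c (L , R , eq) =
        desub-start f h v y (deep-sound 3) (scan-⊑ t embed good) φ (All.map fits c) L [] R eq
        where
        fits : ∀ {i} → T (covered p i) → Fits f h v i
        fits {lit a} _ = tt
        fits {var x} q = subst (λ s → Form σ s (h x) (v x)) (sym (ag x q)) (proj₁ (proj₂ (proj₂ (proj₂ (choice x)))))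

      -- The shapes of the actual values pass every feasibility test, so pruning by feasibility
      -- never discards them.
      feasible-sound : ∀ {p f} → Agrees p f → T (feasible f (restrict p P))
      feasible-sound {p} ag = all⁻ _
        (All.map (λ {ρ} (q , c) → not-null (proj₁ (proj₂ (desub-sound ag ρ c q)))) (restrict-sound p P (proj₂ (proj₂ occ))))

      o-feasible : ∀ x → T (feasible (λ _ → o x) (restrict (x ==_) P))
      o-feasible x = feasible-sound (λ z q → cong o (==-sound q))

      -- The desubstitution step: each fragment contributes one of its decodings, and all of them
      -- are realised in y by the same values v.
      successor : ∀ {p f} → Agrees p f → T (all (all (covered p)) P) →
        ∃ λ P′ → P′ ∈ choices (map (desub f false []) P) × Occurs y P′
      successor {p} ag c
        with choices-complete P (All.zipWith (λ {φ} (d , q) → desub-sound ag φ (all⁺ _ φ d) q)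
               (all⁺ _ P c , proj₂ (proj₂ occ)))
      ... | P′ , P′∈ , ps = P′ , P′∈ , v , (λ x → proj₂ (proj₂ (proj₂ (proj₂ (choice x))))) , ps

      module _ (Λ : List (Formula k)) (j : ℕ)
        (contra : ∀ {P′ : Pattern n k} → T (closes Λ P′ ∨ refute Λ j P′) → ¬ Occurs y P′) where

        assign-sound : ∀ xs p f → All (λ xo → o (proj₁ xo) ∈ proj₂ xo) xs → Agrees p f → ¬ T (assign Λ j P xs p f)
        try-sound : ∀ x os xs p f → o x ∈ os → All (λ xo → o (proj₁ xo) ∈ proj₂ xo) xs →
          (∀ z → T (p z) → update f x (o x) z ≡ o z) → ¬ T (try Λ j P x os xs p f (restrict p P))
        assign-sound [] p f [] ag q with T-∧⁻ {all (all (covered p)) P} q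
        ... | q₁ , q₂ with successor ag q₁
        ...   | P′ , P′∈ , occ′ = contra (All.lookup (all⁺ _ _ q₂) P′∈) occ′
        assign-sound ((x , os) ∷ xs) p f (m ∷ ms) ag q = try-sound x os xs (update p x true) f m ms ag′ q
          where
          ag′ : ∀ z → T (update p x true z) → update f x (o x) z ≡ o z
          ag′ z r with x == z in e
          ... | true = cong o (==-sound (Equivalence.from T-≡ e))
          ... | false = ag z r
        try-sound x (o′ ∷ os) xs p f (here refl) ms ag q
          with T-∨⁻ {not (feasible (update f x (o x)) (restrict p P))}
                 (proj₁ (T-∧⁻ {not (feasible (update f x (o x)) (restrict p P)) ∨ _} q))
        ... | inj₁ r = T-not⁻ r (feasible-sound ag)
        ... | inj₂ r = assign-sound xs p (update f x (o x)) ms ag r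
        try-sound x (o′ ∷ os) xs p f (there m) ms ag q =
          try-sound x os xs p f m ms ag (proj₂ (T-∧⁻ {not (feasible (update f x o′) (restrict p P)) ∨ _} q))

    module _ {k : ℕ} (Λ : List (Formula k)) (absent : All (λ Q → ¬ Occurs {n} {k} y (pattern-of Q)) Λ) where

      -- An occurrence in y is also one in σ(y), where the shape of each variable, taken alone, is
      -- feasible. A match with Λ instead yields an excluded formula in y itself.
      closes-sound : ∀ P → T (closes Λ P) → ¬ Occurs y P
      closes-sound P p occ with T-∨⁻ {any (λ x → stuck (restrict (x ==_) P)) (vars P)} p
      ... | inj₁ q with Any.satisfied (any⁻ (λ x → stuck (restrict (x ==_) P)) (vars P) q)
      ...   | x , r = T-not⁻ (All.lookup (all⁺ _ shapes r) (proj₁ (proj₂ (proj₂ (choice x))))) (o-feasible x)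
        where open Step (Occurs-⊑ embed occ)
      closes-sound P p occ | inj₂ q = absurd Λ absent (any⁻ (matches P) Λ q)
        where
        absurd : ∀ Λ → All (λ Q → ¬ Occurs {n} {k} y (pattern-of Q)) Λ → ¬ Any (T ∘ matches P) Λ
        absurd (Q ∷ _) (a ∷ _) (here r) = a (matches-sound Q P r occ)
        absurd (_ ∷ Λ) (_ ∷ as) (there r) = absurd Λ as r

      -- Induction on j with y fixed: the successor pattern occurs in y, hence again in σ(y), and
      -- the next level applies to the same y.
      refute-sound : ∀ j P → T (refute Λ j P) → ¬ Occurs (σ* y) P
      refute-sound (suc j) P p occ =
        assign-sound Λ j contra (map candidates (vars P)) (λ _ → false) (λ _ → short []) (complete (vars P)) (λ _ ()) p
        where
        open Step occ
        candidates = λ x → x , filterᵇ (λ o → feasible (λ _ → o) (restrict (x ==_) P)) shapes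
        complete : ∀ xs → All (λ xo → o (proj₁ xo) ∈ proj₂ xo) (map candidates xs)
        complete [] = []
        complete (x ∷ xs) = ∈-filter⁺ _ (proj₁ (proj₂ (proj₂ (choice x)))) (o-feasible x) ∷ complete xs
        contra : ∀ {P′} → T (closes Λ P′ ∨ refute Λ j P′) → ¬ Occurs y P′
        contra {P′} q occ′ with T-∨⁻ {closes Λ P′} q
        ... | inj₁ r = closes-sound P′ r occ′
        ... | inj₂ r = refute-sound j P′ r (Occurs-⊑ embed occ′)

-- The prefixes σᵏ(a) of the fixed point.

module _ {X : Set} (d : X) where

  at-++ : ∀ (u w : List X) i → i < length u → at d (u ++ w) i ≡ at d u i
  at-++ (x ∷ u) w zero _ = refl
  at-++ (x ∷ u) w (suc i) (s≤s p) = at-++ u w i p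

  at-prefix : ∀ (u w : List X) → length u ≤ length w → (∀ j → at d w (toℕ j) ≡ lookup u j) → ∃ λ r → u ++ r ≡ w
  at-prefix [] w _ _ = w , refl
  at-prefix (x ∷ u) (y ∷ w) (s≤s p) e with at-prefix u w p (e ∘ suc)
  ... | r , refl = r , cong (_∷ u ++ r) (sym (e zero))

  at-⊑ : ∀ i (u w : List X) → i + length u ≤ length w → (∀ j → at d w (i + toℕ j) ≡ lookup u j) → u ⊑ w
  at-⊑ zero u w p e = [] , at-prefix u w p e
  at-⊑ (suc i) u (y ∷ w) (s≤s p) e with at-⊑ i u w p e
  ... | l , r , refl = y ∷ l , r , refl

module Prolongable {n : ℕ} (σ : Fin n → List (Fin n)) (nonerasing : ∀ a → σ a ≢ [])
  (a : Fin n) {c : List (Fin n)} (σa : σ a ≡ a ∷ c) (c≢[] : c ≢ []) where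

  W : ℕ → List (Fin n)
  W k = iterate σ k (a ∷ [])

  iterate-++ : ∀ k u w → iterate σ k (u ++ w) ≡ iterate σ k u ++ iterate σ k w
  iterate-++ zero u w = refl
  iterate-++ (suc k) u w =
    trans (cong (iterate σ k) (concatMap-++ σ u w)) (iterate-++ k (concatMap σ u) (concatMap σ w))

  iterate-nonempty : ∀ k u → u ≢ [] → iterate σ k u ≢ []
  iterate-nonempty zero u u≢[] = u≢[]
  iterate-nonempty (suc k) [] u≢[] = ⊥-elim (u≢[] refl)
  iterate-nonempty (suc k) (b ∷ u) u≢[] =
    iterate-nonempty k (σ b ++ concatMap σ u) (nonerasing b ∘ ++-conicalˡ (σ b) _)

  -- `iterate` applies the new σ innermost; moving it outside gives W (k + 1) = σ(W k).
  iterate-concatMap : ∀ k u → iterate σ k (concatMap σ u) ≡ concatMap σ (iterate σ k u)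
  iterate-concatMap zero u = refl
  iterate-concatMap (suc k) u = iterate-concatMap k (concatMap σ u)

  -- From σ(a) = a c, applying σᵏ. Thus the words W k form a chain of prefixes.
  W-suc : ∀ k → W (suc k) ≡ W k ++ iterate σ k c
  W-suc k = trans (cong (iterate σ k) (trans (++-identityʳ (σ a)) σa)) (iterate-++ k (a ∷ []) c)

  W-+ : ∀ k i → ∃ λ z → W (k + i) ≡ W k ++ z
  W-+ k zero = [] , trans (cong W (+-identityʳ k)) (sym (++-identityʳ (W k)))
  W-+ k (suc i) with W-+ k i
  ... | z , eq = z ++ iterate σ (k + i) c ,
    trans (cong W (+-suc k i)) (trans (W-suc (k + i)) (trans (cong (_++ _) eq) (++-assoc (W k) z _)))

  W-≤ : ∀ {i j} → i ≤ j → ∃ λ z → W j ≡ W i ++ z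
  W-≤ {i} {j} i≤j = subst (λ m → ∃ λ z → W m ≡ W i ++ z) (m+[n∸m]≡n i≤j) (W-+ i (j ∸ i))

  W-⊑ : ∀ {i j} → i ≤ j → W i ⊑ W j
  W-⊑ i≤j with W-≤ i≤j
  ... | z , eq = [] , z , sym eq

  W-⊑-image : ∀ k → W k ⊑ concatMap σ (W k)
  W-⊑-image k = subst (W k ⊑_) (iterate-concatMap k (a ∷ [])) (W-⊑ (n≤1+n k))

  length-W : ∀ k → k < length (W k)
  length-W zero = s≤s z≤n
  length-W (suc k) with iterate σ k c in eq | W-suc k
  ... | [] | _ = ⊥-elim (iterate-nonempty k c c≢[] eq)
  ... | b ∷ z | e rewrite e | length-++ (W k) {b ∷ z} | +-suc (length (W k)) (length z) =
    s≤s (m≤n⇒m≤n+o (length z) (length-W k))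

  fixedPoint-at : ∀ {i k} → i < k → fixedPoint σ a i ≡ at a (W k) i
  fixedPoint-at {i} i<k with W-≤ i<k
  ... | z , eq = sym (trans (cong (λ w → at a w i) eq) (at-++ a (W (suc i)) z i (<-trans (n<1+n i) (length-W (suc i)))))

  Factor-⊑ : ∀ u → Factor u (fixedPoint σ a) → ∃ λ k → u ⊑ W k
  -- W k has more than k letters, so this index reaches past the end of the factor.
  Factor-⊑ u (i , e) = i + length u ,
    at-⊑ a i u _ (<⇒≤ (length-W (i + length u)))
      (λ j → trans (sym (fixedPoint-at (+-monoʳ-< i (toℕ<n j)))) (e j))

  fragments-⊑ : ∀ {k} (h : Fin k → List (Fin n)) f → All (λ φ → Factor (image h φ) (fixedPoint σ a)) f →
    ∃ λ m → All (λ φ → image h φ ⊑ W m) f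
  fragments-⊑ h [] [] = 0 , []
  fragments-⊑ h (φ ∷ f) (p ∷ ps) with Factor-⊑ (image h φ) p | fragments-⊑ h f ps
  ... | i , q | j , qs = i ⊔ j , ⊑-trans q (W-⊑ (m≤m⊔n i j)) ∷ All.map (λ r → ⊑-trans r (W-⊑ (m≤n⊔m i j))) qs

  -- The Boolean hypothesis says that every variable appears in f; its value is then a factor of
  -- some image, as `Occurs` demands.
  occurrence : ∀ {k} (f : Formula k) → T (all (λ x → any (any (x ==_)) f) (allFin k)) →
    ∀ h → Occurrence f (fixedPoint σ a) h → ∃ λ m → Occurs (W m) (pattern-of f)
  occurrence {k} f used h (h≢[] , ps) with fragments-⊑ h f ps
  ... | m , qs = m , h , (λ x → h≢[] x , var-⊑ f qs (any⁻ _ f (All.lookup (all⁺ _ (allFin k) used) (∈-allFin x)))) ,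
                 All.map⁺ (All.map (λ {φ} → subst (_⊑ W m) (sym (concatMap-map (value h) var φ))) qs)
    where
    letter-⊑ : ∀ {x} φ → Any (T ∘ (x ==_)) φ → h x ⊑ image h φ
    letter-⊑ {x} (z ∷ φ) (here e) with refl ← ==-sound {i = x} {z} e = [] , image h φ , refl
    letter-⊑ (z ∷ φ) (there p) with letter-⊑ φ p
    ... | l , r , eq = h z ++ l , r , trans (++-assoc (h z) l _) (cong (h z ++_) eq)
    var-⊑ : ∀ {x} f → All (λ φ → image h φ ⊑ W m) f → Any (λ φ → T (any (x ==_) φ)) f → h x ⊑ W m
    var-⊑ (φ ∷ f) (q ∷ _) (here p) = ⊑-trans (letter-⊑ φ (any⁻ _ φ p)) q
    var-⊑ (φ ∷ f) (_ ∷ qs) (there p) = var-⊑ f qs p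

-- Induction over the words σⁱ(a).

twoLetters : ∀ {k} → Formula k → Bool
twoLetters ((_ ∷ _ ∷ _) ∷ _) = true
twoLetters _ = false

module Avoidance {n : ℕ} (σ : Fin n → List (Fin n))
  (heads tails : Fin n → List (Fin n × List (Fin n)))
  (shapes : List (Shape n)) (t : Trie n)
  (nonerasing : ∀ a → σ a ≢ [])
  (heads-complete : ∀ {a c r} → σ a ≡ c ∷ r → (a , r) ∈ heads c)
  (tails-complete : ∀ {a c r} l → σ a ≡ l ++ c ∷ r → (a , r) ∈ tails c)
  (recognisable : Recognisable σ shapes)
  (a : Fin n) {c : List (Fin n)} (σa : σ a ≡ a ∷ c) (c≢[] : c ≢ [])
  (closed-windows : T (closed σ t)) (window : T (scan t (a ∷ [])))
  where

  open Search heads tails shapes t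
  open Soundness σ heads tails shapes t nonerasing heads-complete tails-complete recognisable
    using (refute-sound)
  open Prolongable σ nonerasing a σa c≢[]

  Absent : ∀ {k} → Formula k → Set
  Absent f = ∀ i → ¬ Occurs (W i) (pattern-of f)

  scan-W : ∀ i → T (scan t (W i))
  scan-W zero = window
  scan-W (suc i) = subst (T ∘ scan t) (sym (iterate-concatMap i (a ∷ []))) (scan-image σ t closed-windows (W i) (scan-W i))

  two-letters : ∀ {X Y Z r : List (Fin n)} l {b} → X ≢ [] → Y ≢ [] → l ++ (X ++ Y ++ Z) ++ r ≢ b ∷ []
  two-letters {[]} _ X≢[] _ _ = X≢[] refl
  two-letters {_ ∷ _} {[]} _ _ Y≢[] _ = Y≢[] refl
  two-letters {x ∷ []} {y ∷ Y} [] _ _ ()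
  two-letters {x ∷ x′ ∷ X} {y ∷ Y} [] _ _ ()
  two-letters {x ∷ X} {y ∷ Y} (_ ∷ []) _ _ ()
  two-letters {x ∷ X} {y ∷ Y} (_ ∷ _ ∷ _) _ _ ()

  absent : ∀ {k} (f : Formula k) Λ j → T (twoLetters f) → All Absent Λ →
    refute (f ∷ Λ) j (pattern-of f) ≡ true → Absent f
  -- Base case: σ⁰(a) is one letter, too short for two consecutive non-empty values.
  absent ((x ∷ z ∷ _) ∷ _) Λ j _ _ _ zero (h , hs , (l , r , eq) ∷ _) =
    two-letters l (proj₁ (hs x)) (proj₁ (hs z)) eq
  absent f Λ j two as p (suc i) occ =
    -- The formula f joins its own list of excluded formulas: its absence from W i is the induction
    -- hypothesis.
    refute-sound (W i) (subst (T ∘ scan t) (iterate-concatMap i (a ∷ [])) (scan-W (suc i))) (W-⊑-image i)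
      (f ∷ Λ) (absent f Λ j two as p i ∷ All.map (λ q → q i) as) j (pattern-of f) (Equivalence.from T-≡ p)
      (subst (λ w → Occurs w (pattern-of f)) (iterate-concatMap i (a ∷ [])) occ)

  avoids : ∀ {k} (f : Formula k) → T (all (λ x → any (any (x ==_)) f) (allFin k)) →
    Absent f → Avoids (fixedPoint σ a) f
  avoids f used abs (h , occ) with occurrence f used h occ
  ... | m , occ′ = abs m occ′

-- Recognisability from block boundaries and left-to-right decoding.

module _ {n : ℕ} (σ : Fin n → List (Fin n)) where

  Synchronised : (s X : List (Fin n)) → Set
  Synchronised s X = ∀ L R y → L ++ (s ++ X) ++ R ≡ concatMap σ y →
    ∃₂ λ y₁ y₂ → y₁ ++ y₂ ≡ y × L ++ s ≡ concatMap σ y₁ × X ++ R ≡ concatMap σ y₂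

  -- X is read from a block boundary as σ(v) t, with v and t independent of what follows X. If
  -- nothing is decoded, X itself is an end, which leads to a short shape.
  Decoded : (ends : List (List (Fin n))) (X : List (Fin n)) → Set
  Decoded ends X = ∃₂ λ v t → t ∈ ends × (v ≢ [] ⊎ X ≡ t) ×
    (∀ R y → X ++ R ≡ concatMap σ y → ∃ λ y₂ → v ++ y₂ ≡ y × t ++ R ≡ concatMap σ y₂)

  decoded-end : ∀ {ends t} → t ∈ ends → Decoded ends t
  decoded-end {t = t} t∈ = [] , t , t∈ , inj₂ refl , λ R y eq → y , refl , eq

  decoded-∷ : ∀ {ends} a {X X′} →
    (∀ R y → X′ ++ R ≡ concatMap σ y → ∃ λ y′ → a ∷ y′ ≡ y × X ++ R ≡ concatMap σ y′) →
    Decoded ends X → Decoded ends X′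
  decoded-∷ a {X} {X′} step (v , t , t∈ , _ , dec) = a ∷ v , t , t∈ , inj₁ (λ ()) , dec′
    where
    dec′ : ∀ R y → X′ ++ R ≡ concatMap σ y → ∃ λ y₂ → a ∷ v ++ y₂ ≡ y × t ++ R ≡ concatMap σ y₂
    dec′ R y eq with step R y eq
    ... | y′ , refl , eq′ with dec R y′ eq′
    ...   | y₂ , refl , q = y₂ , refl , q

  -- The hypothesis forces c to open its block, so the boundary lies just before it; in `sync-after`
  -- the letter closes its block.
  sync-before : ∀ {c X} → (∀ a l r R y → σ a ≡ l ++ c ∷ r → X ++ R ≡ r ++ concatMap σ y → l ≡ []) → Synchronised [] (c ∷ X)
  sync-before {c} {X} block L R y eq with locate σ y L eq
  ... | y₀ , y₁ , l , r , a , refl , e , refl , q with block a l r R y₁ e q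
  ...   | refl = y₀ , a ∷ y₁ , refl ,
    trans (++-identityʳ _) (++-identityʳ _) , trans (cong (c ∷_) q) (cong (_++ concatMap σ y₁) (sym e))

  sync-after : ∀ {c X} → (∀ a l r R y → σ a ≡ l ++ c ∷ r → X ++ R ≡ r ++ concatMap σ y → r ≡ []) → Synchronised (c ∷ []) X
  sync-after {c} {X} block L R y eq with locate σ y L eq
  ... | y₀ , y₁ , l , r , a , refl , e , refl , q with block a l r R y₁ e q
  ...   | refl = y₀ ++ a ∷ [] , y₁ , ++-assoc y₀ _ y₁ ,
    trans (++-assoc (concatMap σ y₀) l _)
      (trans (cong (concatMap σ y₀ ++_) (trans (sym e) (sym (++-identityʳ (σ a))))) (sym (concatMap-++ σ y₀ (a ∷ [])))) , q

  -- Both the boundary after s and the decoding of X are the same at every occurrence, which is what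
  -- alignment asks.
  recognised : ∀ {shapes ends s X} → (∀ {t} → t ∈ ends → long s t ∈ shapes) →
    (∀ {t} → t ∈ ends → s ++ t ≢ [] → short (s ++ t) ∈ shapes) →
    Synchronised s X → (∀ R y → X ++ R ≡ concatMap σ y → Decoded ends X) →
    ∀ y → s ++ X ≢ [] → (s ++ X) ⊑ concatMap σ y → ∃₂ λ o v → o ∈ shapes × Form σ o (s ++ X) v
  recognised {s = s} {X} long∈ short∈ sync decode y ne (L , R , eq) with sync L R y eq
  ... | _ , y₂ , _ , _ , q with decode R y₂ q
  ...   | v , t , t∈ , inj₂ refl , _ = short (s ++ t) , [] , short∈ t∈ ne , isShort
  ...   | v , t , t∈ , inj₁ v≢[] , dec = long s t , v , long∈ t∈ , isLong v≢[] al
    where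
    al : Aligned σ s t (s ++ X) v
    al L R y eq with sync L R y eq
    ... | y₁ , y₂ , refl , q₁ , q₂ with dec R y₂ q₂
    ...   | y₃ , refl , q₃ = y₁ , y₃ , refl , q₁ , q₃

-- The morphism of z₃.

σz-nonerasing : ∀ a → σz a ≢ []
σz-nonerasing zero ()
σz-nonerasing (suc zero) ()
σz-nonerasing (suc (suc zero)) ()

headsZ tailsZ : Fin 3 → List (Fin 3 × List (Fin 3))
headsZ zero = (m0 , m1 ∷ []) ∷ []
headsZ (suc zero) = []
headsZ (suc (suc zero)) = (m1 , []) ∷ (m2 , m0 ∷ []) ∷ []
tailsZ zero = (m0 , m1 ∷ []) ∷ (m2 , []) ∷ []
tailsZ (suc zero) = (m0 , []) ∷ []
tailsZ (suc (suc zero)) = (m1 , []) ∷ (m2 , m0 ∷ []) ∷ []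

headsZ-complete : ∀ {a c r} → σz a ≡ c ∷ r → (a , r) ∈ headsZ c
headsZ-complete {zero} refl = here refl
headsZ-complete {suc zero} refl = here refl
headsZ-complete {suc (suc zero)} refl = there (here refl)

tailsZ-complete : ∀ {a c r} l → σz a ≡ l ++ c ∷ r → (a , r) ∈ tailsZ c
tailsZ-complete {zero} [] refl = here refl
tailsZ-complete {zero} (_ ∷ []) refl = here refl
tailsZ-complete {zero} (_ ∷ _ ∷ []) ()
tailsZ-complete {zero} (_ ∷ _ ∷ _ ∷ _) ()
tailsZ-complete {suc zero} [] refl = here refl
tailsZ-complete {suc zero} (_ ∷ []) ()
tailsZ-complete {suc zero} (_ ∷ _ ∷ _) ()
tailsZ-complete {suc (suc zero)} [] refl = there (here refl)
tailsZ-complete {suc (suc zero)} (_ ∷ []) refl = there (here refl)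
tailsZ-complete {suc (suc zero)} (_ ∷ _ ∷ []) ()
tailsZ-complete {suc (suc zero)} (_ ∷ _ ∷ _ ∷ _) ()

-- Starts are the proper suffixes of blocks. Among the ends, 2 may be the block 2 or begin 20, and
-- 20 may be one block or 2 followed by the beginning of 01; undecided letters stay in the end.
startsZ endsZ : List (List (Fin 3))
startsZ = [] ∷ (m0 ∷ []) ∷ (m1 ∷ []) ∷ []
endsZ = [] ∷ (m0 ∷ []) ∷ (m2 ∷ []) ∷ (m2 ∷ m0 ∷ []) ∷ []

shortsZ : List (List (Fin 3))
shortsZ = (m0 ∷ []) ∷ (m1 ∷ []) ∷ (m2 ∷ []) ∷ (m2 ∷ m0 ∷ []) ∷ (m0 ∷ m0 ∷ []) ∷ (m0 ∷ m2 ∷ []) ∷ (m0 ∷ m2 ∷ m0 ∷ [])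
  ∷ (m1 ∷ m0 ∷ []) ∷ (m1 ∷ m2 ∷ []) ∷ (m1 ∷ m2 ∷ m0 ∷ []) ∷ []

shapesZ : List (Shape 3)
shapesZ = cartesianProductWith long startsZ endsZ ++ map short shortsZ

-- The set passes the test `closed`, so every σᵏ(0) has only these factors of length four.
windowsZ : Trie 3
windowsZ = foldr insert dead
  ( (m0 ∷ m0 ∷ m1 ∷ m0 ∷ []) ∷ (m0 ∷ m0 ∷ m1 ∷ m2 ∷ []) ∷ (m0 ∷ m1 ∷ m0 ∷ m1 ∷ [])
  ∷ (m0 ∷ m1 ∷ m2 ∷ m0 ∷ []) ∷ (m0 ∷ m1 ∷ m2 ∷ m2 ∷ []) ∷ (m0 ∷ m2 ∷ m0 ∷ m0 ∷ [])
  ∷ (m1 ∷ m0 ∷ m1 ∷ m2 ∷ []) ∷ (m1 ∷ m2 ∷ m0 ∷ m0 ∷ []) ∷ (m1 ∷ m2 ∷ m0 ∷ m1 ∷ [])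
  ∷ (m1 ∷ m2 ∷ m2 ∷ m0 ∷ []) ∷ (m2 ∷ m0 ∷ m0 ∷ m1 ∷ []) ∷ (m2 ∷ m0 ∷ m1 ∷ m2 ∷ [])
  ∷ (m2 ∷ m0 ∷ m2 ∷ m0 ∷ []) ∷ (m2 ∷ m2 ∷ m0 ∷ m0 ∷ []) ∷ (m2 ∷ m2 ∷ m0 ∷ m2 ∷ []) ∷ [])

σz-block0 : ∀ a l {r} → σz a ≡ l ++ m0 ∷ r → (l ≡ [] × r ≡ m1 ∷ []) ⊎ r ≡ []
σz-block0 zero [] refl = inj₁ (refl , refl)
σz-block0 zero (_ ∷ []) ()
σz-block0 zero (_ ∷ _ ∷ []) ()
σz-block0 zero (_ ∷ _ ∷ _ ∷ _) ()
σz-block0 (suc zero) [] ()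
σz-block0 (suc zero) (_ ∷ []) ()
σz-block0 (suc zero) (_ ∷ _ ∷ _) ()
σz-block0 (suc (suc zero)) [] ()
σz-block0 (suc (suc zero)) (_ ∷ []) refl = inj₂ refl
σz-block0 (suc (suc zero)) (_ ∷ _ ∷ []) ()
σz-block0 (suc (suc zero)) (_ ∷ _ ∷ _ ∷ _) ()

σz-block1 : ∀ a l {r} → σz a ≡ l ++ m1 ∷ r → r ≡ []
σz-block1 zero (_ ∷ []) refl = refl
σz-block1 zero (_ ∷ _ ∷ []) ()
σz-block1 zero (_ ∷ _ ∷ _ ∷ _) ()
σz-block1 (suc zero) (_ ∷ []) ()
σz-block1 (suc zero) (_ ∷ _ ∷ _) ()
σz-block1 (suc (suc zero)) (_ ∷ []) ()
σz-block1 (suc (suc zero)) (_ ∷ _ ∷ []) ()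
σz-block1 (suc (suc zero)) (_ ∷ _ ∷ _ ∷ _) ()

σz-block2 : ∀ a l {r} → σz a ≡ l ++ m2 ∷ r → l ≡ []
σz-block2 a [] _ = refl
σz-block2 zero (_ ∷ []) ()
σz-block2 zero (_ ∷ _ ∷ []) ()
σz-block2 zero (_ ∷ _ ∷ _ ∷ _) ()
σz-block2 (suc zero) (_ ∷ []) ()
σz-block2 (suc zero) (_ ∷ _ ∷ _) ()
σz-block2 (suc (suc zero)) (_ ∷ []) ()
σz-block2 (suc (suc zero)) (_ ∷ _ ∷ []) ()
σz-block2 (suc (suc zero)) (_ ∷ _ ∷ _ ∷ _) ()

σz-1∷ : ∀ {w} y → m1 ∷ w ≢ concatMap σz y
σz-1∷ (zero ∷ y) ()
σz-1∷ (suc zero ∷ y) ()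
σz-1∷ (suc (suc zero) ∷ y) ()

σz-0∷ : ∀ {w} y → m0 ∷ w ≡ concatMap σz y → ∃ λ y′ → m0 ∷ y′ ≡ y × w ≡ m1 ∷ concatMap σz y′
σz-0∷ (zero ∷ y) refl = y , refl , refl
σz-0∷ (suc zero ∷ y) ()
σz-0∷ (suc (suc zero) ∷ y) ()

σz-2∷ : ∀ {w} y → m2 ∷ w ≡ concatMap σz y →
  (∃ λ y′ → m1 ∷ y′ ≡ y × w ≡ concatMap σz y′) ⊎ (∃ λ y′ → m2 ∷ y′ ≡ y × w ≡ m0 ∷ concatMap σz y′)
σz-2∷ (suc zero ∷ y) refl = inj₁ (y , refl , refl)
σz-2∷ (suc (suc zero) ∷ y) refl = inj₂ (y , refl , refl)

-- A letter 2 is the block 2 or opens 20, and up to two further letters decide. The two function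
-- arguments decode the remainder after the block 2 and after the block 20, respectively.
decode2 : ∀ c X R y → m2 ∷ c ∷ X ++ R ≡ concatMap σz y →
  (∀ R y → c ∷ X ++ R ≡ concatMap σz y → Decoded σz endsZ (c ∷ X)) →
  (∀ R y → X ++ R ≡ concatMap σz y → Decoded σz endsZ X) → Decoded σz endsZ (m2 ∷ c ∷ X)
decode2 (suc zero) X R y eq _ _ with σz-2∷ y eq
... | inj₁ (y′ , _ , q) = ⊥-elim (σz-1∷ y′ q)
decode2 (suc (suc zero)) X R y eq rec₀ _ =
  decoded-∷ σz m1 step (rec₀ R (proj₁ (step R y eq)) (proj₂ (proj₂ (step R y eq))))
  where
  step : ∀ R y → m2 ∷ m2 ∷ X ++ R ≡ concatMap σz y → ∃ λ y′ → m1 ∷ y′ ≡ y × m2 ∷ X ++ R ≡ concatMap σz y′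
  step R y eq with σz-2∷ y eq
  ... | inj₁ r = r
decode2 zero [] R y eq _ _ = decoded-end σz (there (there (there (here refl))))
-- Here 0 is followed by 1, so 01 is a block and the 2 before it stands alone.
decode2 zero X@(suc zero ∷ _) R y eq rec₀ _ =
  decoded-∷ σz m1 step (rec₀ R (proj₁ (step R y eq)) (proj₂ (proj₂ (step R y eq))))
  where
  step : ∀ R y → m2 ∷ m0 ∷ X ++ R ≡ concatMap σz y → ∃ λ y′ → m1 ∷ y′ ≡ y × m0 ∷ X ++ R ≡ concatMap σz y′
  step R y eq with σz-2∷ y eq
  ... | inj₁ r = r
  ... | inj₂ (y′ , _ , q) = ⊥-elim (σz-1∷ y′ (∷-injectiveʳ q))
-- A 0 not followed by 1 cannot open 01, so it closes the block 20.
decode2 zero X@(zero ∷ _) R y eq _ rec =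
  decoded-∷ σz m2 step (rec R (proj₁ (step R y eq)) (proj₂ (proj₂ (step R y eq))))
  where
  step : ∀ R y → m2 ∷ m0 ∷ X ++ R ≡ concatMap σz y → ∃ λ y′ → m2 ∷ y′ ≡ y × X ++ R ≡ concatMap σz y′
  step R y eq with σz-2∷ y eq
  ... | inj₂ (y′ , p , q) = y′ , p , ∷-injectiveʳ q
  ... | inj₁ (y′ , _ , q) with σz-0∷ y′ q
  ...   | _ , _ , ()
decode2 zero X@(suc (suc zero) ∷ _) R y eq _ rec =
  decoded-∷ σz m2 step (rec R (proj₁ (step R y eq)) (proj₂ (proj₂ (step R y eq))))
  where
  step : ∀ R y → m2 ∷ m0 ∷ X ++ R ≡ concatMap σz y → ∃ λ y′ → m2 ∷ y′ ≡ y × X ++ R ≡ concatMap σz y′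
  step R y eq with σz-2∷ y eq
  ... | inj₂ (y′ , p , q) = y′ , p , ∷-injectiveʳ q
  ... | inj₁ (y′ , _ , q) with σz-0∷ y′ q
  ...   | _ , _ , ()

decodeZ : ∀ X R y → X ++ R ≡ concatMap σz y → Decoded σz endsZ X
decodeZ [] R y _ = decoded-end σz (here refl)
decodeZ (zero ∷ []) R y _ = decoded-end σz (there (here refl))
decodeZ (zero ∷ zero ∷ X) R y eq with σz-0∷ y eq
... | _ , _ , ()
decodeZ (zero ∷ suc zero ∷ X) R y eq = decoded-∷ σz m0 step (decodeZ X R (proj₁ (step R y eq)) (proj₂ (proj₂ (step R y eq))))
  where
  step : ∀ R y → m0 ∷ m1 ∷ X ++ R ≡ concatMap σz y → ∃ λ y′ → m0 ∷ y′ ≡ y × X ++ R ≡ concatMap σz y′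
  step R y eq with σz-0∷ y eq
  ... | y′ , p , q = y′ , p , ∷-injectiveʳ q
decodeZ (zero ∷ suc (suc zero) ∷ X) R y eq with σz-0∷ y eq
... | _ , _ , ()
decodeZ (suc zero ∷ X) R y eq = ⊥-elim (σz-1∷ y eq)
decodeZ (suc (suc zero) ∷ []) R y _ = decoded-end σz (there (there (here refl)))
decodeZ (suc (suc zero) ∷ c ∷ X) R y eq = decode2 c X R y eq (decodeZ (c ∷ X)) (decodeZ X)

longZ-∈ : ∀ {s t} → s ∈ startsZ → t ∈ endsZ → long s t ∈ shapesZ
longZ-∈ s∈ t∈ = ∈-++⁺ˡ (∈-cartesianProductWith⁺ long s∈ t∈)

shortZ-∈ : ∀ {s t} → s ∈ startsZ → t ∈ endsZ → s ++ t ≢ [] → short (s ++ t) ∈ shapesZ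
shortZ-∈ s∈ t∈ ne = ∈-++⁺ʳ (cartesianProductWith long startsZ endsZ) (∈-map⁺ short (member s∈ t∈ ne))
  where
  member : ∀ {s t} → s ∈ startsZ → t ∈ endsZ → s ++ t ≢ [] → s ++ t ∈ shortsZ
  member (here refl) (here refl) ne = ⊥-elim (ne refl)
  member (here refl) (there (here refl)) _ = here refl
  member (here refl) (there (there (here refl))) _ = there (there (here refl))
  member (here refl) (there (there (there (here refl)))) _ = there (there (there (here refl)))
  member (there (here refl)) (here refl) _ = here refl
  member (there (here refl)) (there (here refl)) _ = there (there (there (there (here refl))))
  member (there (here refl)) (there (there (here refl))) _ = there (there (there (there (there (here refl)))))
  member (there (here refl)) (there (there (there (here refl)))) _ = there (there (there (there (there (there (here refl))))))
  member (there (there (here refl))) (here refl) _ = there (here refl)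
  member (there (there (here refl))) (there (here refl)) _ = there (there (there (there (there (there (there (here refl)))))))
  member (there (there (here refl))) (there (there (here refl))) _ = there (there (there (there (there (there (there (there (here refl))))))))
  member (there (there (here refl))) (there (there (there (here refl)))) _ = there (there (there (there (there (there (there (there (there (here refl)))))))))

-- The first letter fixes a boundary, except that 0 needs its successor: before 1 it opens a block,
-- before 0 or 2 it closes one. A lone 0 is short.
recogniseZ : Recognisable σz shapesZ
recogniseZ [] y X≢[] _ = ⊥-elim (X≢[] refl)
recogniseZ (zero ∷ []) y ne _ = short (m0 ∷ []) , [] , shortZ-∈ (here refl) (there (here refl)) ne , isShort
recogniseZ (zero ∷ zero ∷ X) y =
  recognised σz {s = m0 ∷ []} (longZ-∈ (there (here refl))) (shortZ-∈ (there (here refl))) (sync-after σz block) (decodeZ (m0 ∷ X)) y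
  where
  block : ∀ a l r R y → σz a ≡ l ++ m0 ∷ r → m0 ∷ X ++ R ≡ r ++ concatMap σz y → r ≡ []
  block a l r R y e q with σz-block0 a l e
  ... | inj₂ p = p
  ... | inj₁ (_ , refl) with () ← q
recogniseZ (zero ∷ suc zero ∷ X) y =
  recognised σz {s = []} (longZ-∈ (here refl)) (shortZ-∈ (here refl)) (sync-before σz block) (decodeZ (m0 ∷ m1 ∷ X)) y
  where
  block : ∀ a l r R y → σz a ≡ l ++ m0 ∷ r → m1 ∷ X ++ R ≡ r ++ concatMap σz y → l ≡ []
  block a l r R y e q with σz-block0 a l e
  ... | inj₁ (p , _) = p
  ... | inj₂ refl = ⊥-elim (σz-1∷ y q)
recogniseZ (zero ∷ suc (suc zero) ∷ X) y =
  recognised σz {s = m0 ∷ []} (longZ-∈ (there (here refl))) (shortZ-∈ (there (here refl))) (sync-after σz block) (decodeZ (m2 ∷ X)) y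
  where
  block : ∀ a l r R y → σz a ≡ l ++ m0 ∷ r → m2 ∷ X ++ R ≡ r ++ concatMap σz y → r ≡ []
  block a l r R y e q with σz-block0 a l e
  ... | inj₂ p = p
  ... | inj₁ (_ , refl) with () ← q
recogniseZ (suc zero ∷ X) y =
  recognised σz {s = m1 ∷ []} (longZ-∈ (there (there (here refl)))) (shortZ-∈ (there (there (here refl))))
    (sync-after σz (λ a l r R y e _ → σz-block1 a l e)) (decodeZ X) y
recogniseZ (suc (suc zero) ∷ X) y =
  recognised σz {s = []} (longZ-∈ (here refl)) (shortZ-∈ (here refl))
    (sync-before σz (λ a l r R y e _ → σz-block2 a l e)) (decodeZ (m2 ∷ X)) y

-- The morphism of b₄.

σb-nonerasing : ∀ a → σb a ≢ []
σb-nonerasing zero ()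
σb-nonerasing (suc zero) ()
σb-nonerasing (suc (suc zero)) ()
σb-nonerasing (suc (suc (suc zero))) ()

headsB tailsB : Fin 4 → List (Fin 4 × List (Fin 4))
headsB zero = (l0 , l1 ∷ []) ∷ (l1 , l3 ∷ []) ∷ []
headsB (suc zero) = []
headsB (suc (suc zero)) = (l2 , l1 ∷ []) ∷ (l3 , l3 ∷ []) ∷ []
headsB (suc (suc (suc zero))) = []
tailsB zero = (l0 , l1 ∷ []) ∷ (l1 , l3 ∷ []) ∷ []
tailsB (suc zero) = (l0 , []) ∷ (l2 , []) ∷ []
tailsB (suc (suc zero)) = (l2 , l1 ∷ []) ∷ (l3 , l3 ∷ []) ∷ []
tailsB (suc (suc (suc zero))) = (l1 , []) ∷ (l3 , []) ∷ []

headsB-complete : ∀ {a c r} → σb a ≡ c ∷ r → (a , r) ∈ headsB c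
headsB-complete {zero} refl = here refl
headsB-complete {suc zero} refl = there (here refl)
headsB-complete {suc (suc zero)} refl = here refl
headsB-complete {suc (suc (suc zero))} refl = there (here refl)

two-letter-split : {X : Set} {x y c : X} (l : List X) {r : List X} → x ∷ y ∷ [] ≡ l ++ c ∷ r →
  (l ≡ [] × c ≡ x × r ≡ y ∷ []) ⊎ (l ≡ x ∷ [] × c ≡ y × r ≡ [])
two-letter-split [] refl = inj₁ (refl , refl , refl)
two-letter-split (_ ∷ []) refl = inj₂ (refl , refl , refl)
two-letter-split (_ ∷ _ ∷ []) ()
two-letter-split (_ ∷ _ ∷ _ ∷ _) ()

tailsB-complete : ∀ {a c r} l → σb a ≡ l ++ c ∷ r → (a , r) ∈ tailsB c
tailsB-complete {zero} l e with two-letter-split l e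
... | inj₁ (_ , refl , refl) = here refl
... | inj₂ (_ , refl , refl) = here refl
tailsB-complete {suc zero} l e with two-letter-split l e
... | inj₁ (_ , refl , refl) = there (here refl)
... | inj₂ (_ , refl , refl) = here refl
tailsB-complete {suc (suc zero)} l e with two-letter-split l e
... | inj₁ (_ , refl , refl) = here refl
... | inj₂ (_ , refl , refl) = there (here refl)
tailsB-complete {suc (suc (suc zero))} l e with two-letter-split l e
... | inj₁ (_ , refl , refl) = there (here refl)
... | inj₂ (_ , refl , refl) = there (here refl)

-- The letters 0 and 2 only open blocks, 1 and 3 only close them. So the first letter of a factor
-- fixes all boundaries, and at most one letter is left over on each side.
startsB endsB : List (List (Fin 4))
startsB = [] ∷ (l1 ∷ []) ∷ (l3 ∷ []) ∷ []
endsB = [] ∷ (l0 ∷ []) ∷ (l2 ∷ []) ∷ []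

shortsB : List (List (Fin 4))
shortsB = (l0 ∷ []) ∷ (l2 ∷ []) ∷ (l1 ∷ []) ∷ (l3 ∷ []) ∷ (l1 ∷ l0 ∷ []) ∷ (l1 ∷ l2 ∷ []) ∷ (l3 ∷ l0 ∷ []) ∷ (l3 ∷ l2 ∷ []) ∷ []

shapesB : List (Shape 4)
shapesB = cartesianProductWith long startsB endsB ++ map short shortsB

windowsB : Trie 4
windowsB = foldr insert dead
  ( (l0 ∷ l1 ∷ l0 ∷ l3 ∷ []) ∷ (l0 ∷ l1 ∷ l2 ∷ l3 ∷ []) ∷ (l0 ∷ l3 ∷ l0 ∷ l1 ∷ []) ∷ (l0 ∷ l3 ∷ l2 ∷ l1 ∷ [])
  ∷ (l1 ∷ l0 ∷ l3 ∷ l0 ∷ []) ∷ (l1 ∷ l0 ∷ l3 ∷ l2 ∷ []) ∷ (l1 ∷ l2 ∷ l3 ∷ l0 ∷ []) ∷ (l1 ∷ l2 ∷ l3 ∷ l2 ∷ [])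
  ∷ (l2 ∷ l1 ∷ l0 ∷ l3 ∷ []) ∷ (l2 ∷ l1 ∷ l2 ∷ l3 ∷ []) ∷ (l2 ∷ l3 ∷ l0 ∷ l1 ∷ []) ∷ (l2 ∷ l3 ∷ l2 ∷ l1 ∷ [])
  ∷ (l3 ∷ l0 ∷ l1 ∷ l0 ∷ []) ∷ (l3 ∷ l0 ∷ l1 ∷ l2 ∷ []) ∷ (l3 ∷ l2 ∷ l1 ∷ l0 ∷ []) ∷ (l3 ∷ l2 ∷ l1 ∷ l2 ∷ []) ∷ [])

σb-heads : ∀ a l {c r} → σb a ≡ l ++ c ∷ r → c ∈ l0 ∷ l2 ∷ [] → l ≡ []
σb-heads zero l e c∈ with two-letter-split l e | c∈
... | inj₁ (p , _) | _ = p
... | inj₂ (_ , refl , _) | here ()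
... | inj₂ (_ , refl , _) | there (here ())
σb-heads (suc zero) l e c∈ with two-letter-split l e | c∈
... | inj₁ (p , _) | _ = p
... | inj₂ (_ , refl , _) | here ()
... | inj₂ (_ , refl , _) | there (here ())
σb-heads (suc (suc zero)) l e c∈ with two-letter-split l e | c∈
... | inj₁ (p , _) | _ = p
... | inj₂ (_ , refl , _) | here ()
... | inj₂ (_ , refl , _) | there (here ())
σb-heads (suc (suc (suc zero))) l e c∈ with two-letter-split l e | c∈
... | inj₁ (p , _) | _ = p
... | inj₂ (_ , refl , _) | here ()
... | inj₂ (_ , refl , _) | there (here ())

σb-lasts : ∀ a l {c r} → σb a ≡ l ++ c ∷ r → c ∈ l1 ∷ l3 ∷ [] → r ≡ []
σb-lasts zero l e c∈ with two-letter-split l e | c∈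
... | inj₂ (_ , _ , p) | _ = p
... | inj₁ (_ , refl , _) | here ()
... | inj₁ (_ , refl , _) | there (here ())
σb-lasts (suc zero) l e c∈ with two-letter-split l e | c∈
... | inj₂ (_ , _ , p) | _ = p
... | inj₁ (_ , refl , _) | here ()
... | inj₁ (_ , refl , _) | there (here ())
σb-lasts (suc (suc zero)) l e c∈ with two-letter-split l e | c∈
... | inj₂ (_ , _ , p) | _ = p
... | inj₁ (_ , refl , _) | here ()
... | inj₁ (_ , refl , _) | there (here ())
σb-lasts (suc (suc (suc zero))) l e c∈ with two-letter-split l e | c∈
... | inj₂ (_ , _ , p) | _ = p
... | inj₁ (_ , refl , _) | here ()
... | inj₁ (_ , refl , _) | there (here ())

-- The four images are distinct words of equal length, so a full block determines its letter.
σb-++ : ∀ a {w} y → σb a ++ w ≡ concatMap σb y → ∃ λ y′ → a ∷ y′ ≡ y × w ≡ concatMap σb y′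
σb-++ a [] eq = ⊥-elim (σb-nonerasing a (++-conicalˡ (σb a) _ eq))
σb-++ zero (zero ∷ y) refl = y , refl , refl
σb-++ zero (suc zero ∷ y) ()
σb-++ zero (suc (suc zero) ∷ y) ()
σb-++ zero (suc (suc (suc zero)) ∷ y) ()
σb-++ (suc zero) (suc zero ∷ y) refl = y , refl , refl
σb-++ (suc zero) (suc (suc zero) ∷ y) ()
σb-++ (suc zero) (suc (suc (suc zero)) ∷ y) ()
σb-++ (suc (suc zero)) (suc (suc zero) ∷ y) refl = y , refl , refl
σb-++ (suc (suc zero)) (suc (suc (suc zero)) ∷ y) ()
σb-++ (suc (suc (suc zero))) (suc (suc (suc zero)) ∷ y) refl = y , refl , refl

decodeB : ∀ X R y → X ++ R ≡ concatMap σb y → Decoded σb endsB X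
decodeB [] R y _ = decoded-end σb (here refl)
decodeB (_ ∷ []) R (zero ∷ y) refl = decoded-end σb (there (here refl))
decodeB (_ ∷ []) R (suc zero ∷ y) refl = decoded-end σb (there (here refl))
decodeB (_ ∷ []) R (suc (suc zero) ∷ y) refl = decoded-end σb (there (there (here refl)))
decodeB (_ ∷ []) R (suc (suc (suc zero)) ∷ y) refl = decoded-end σb (there (there (here refl)))
decodeB (_ ∷ _ ∷ X) R (zero ∷ y) eq with refl ← ∷-injectiveˡ eq | refl ← ∷-injectiveˡ (∷-injectiveʳ eq) =
  decoded-∷ σb l0 (λ R → σb-++ l0) (decodeB X R y (∷-injectiveʳ (∷-injectiveʳ eq)))
decodeB (_ ∷ _ ∷ X) R (suc zero ∷ y) eq with refl ← ∷-injectiveˡ eq | refl ← ∷-injectiveˡ (∷-injectiveʳ eq) =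
  decoded-∷ σb l1 (λ R → σb-++ l1) (decodeB X R y (∷-injectiveʳ (∷-injectiveʳ eq)))
decodeB (_ ∷ _ ∷ X) R (suc (suc zero) ∷ y) eq with refl ← ∷-injectiveˡ eq | refl ← ∷-injectiveˡ (∷-injectiveʳ eq) =
  decoded-∷ σb l2 (λ R → σb-++ l2) (decodeB X R y (∷-injectiveʳ (∷-injectiveʳ eq)))
decodeB (_ ∷ _ ∷ X) R (suc (suc (suc zero)) ∷ y) eq with refl ← ∷-injectiveˡ eq | refl ← ∷-injectiveˡ (∷-injectiveʳ eq) =
  decoded-∷ σb l3 (λ R → σb-++ l3) (decodeB X R y (∷-injectiveʳ (∷-injectiveʳ eq)))

longB-∈ : ∀ {s t} → s ∈ startsB → t ∈ endsB → long s t ∈ shapesB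
longB-∈ s∈ t∈ = ∈-++⁺ˡ (∈-cartesianProductWith⁺ long s∈ t∈)

shortB-∈ : ∀ {s t} → s ∈ startsB → t ∈ endsB → s ++ t ≢ [] → short (s ++ t) ∈ shapesB
shortB-∈ s∈ t∈ ne = ∈-++⁺ʳ (cartesianProductWith long startsB endsB) (∈-map⁺ short (member s∈ t∈ ne))
  where
  member : ∀ {s t} → s ∈ startsB → t ∈ endsB → s ++ t ≢ [] → s ++ t ∈ shortsB
  member (here refl) (here refl) ne = ⊥-elim (ne refl)
  member (here refl) (there (here refl)) _ = here refl
  member (here refl) (there (there (here refl))) _ = there (here refl)
  member (there (here refl)) (here refl) _ = there (there (here refl))
  member (there (here refl)) (there (here refl)) _ = there (there (there (there (here refl))))
  member (there (here refl)) (there (there (here refl))) _ = there (there (there (there (there (here refl)))))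
  member (there (there (here refl))) (here refl) _ = there (there (there (here refl)))
  member (there (there (here refl))) (there (here refl)) _ = there (there (there (there (there (there (here refl))))))
  member (there (there (here refl))) (there (there (here refl))) _ = there (there (there (there (there (there (there (here refl)))))))

recogniseB : Recognisable σb shapesB
recogniseB [] y X≢[] _ = ⊥-elim (X≢[] refl)
recogniseB (zero ∷ X) y = recognised σb {s = []} (longB-∈ (here refl)) (shortB-∈ (here refl))
  (sync-before σb (λ a l r R y e _ → σb-heads a l e (here refl))) (decodeB (l0 ∷ X)) y
recogniseB (suc zero ∷ X) y = recognised σb {s = l1 ∷ []} (longB-∈ (there (here refl))) (shortB-∈ (there (here refl)))
  (sync-after σb (λ a l r R y e _ → σb-lasts a l e (here refl))) (decodeB X) y
recogniseB (suc (suc zero) ∷ X) y = recognised σb {s = []} (longB-∈ (here refl)) (shortB-∈ (here refl))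
  (sync-before σb (λ a l r R y e _ → σb-heads a l e (there (here refl)))) (decodeB (l2 ∷ X)) y
recogniseB (suc (suc (suc zero)) ∷ X) y =
  recognised σb {s = l3 ∷ []} (longB-∈ (there (there (here refl)))) (shortB-∈ (there (there (here refl))))
    (sync-after σb (λ a l r R y e _ → σb-lasts a l e (there (here refl)))) (decodeB X) y

-- Running the search for each formula.

module Z = Avoidance σz headsZ tailsZ shapesZ windowsZ σz-nonerasing headsZ-complete tailsZ-complete recogniseZ
  -- The last two arguments hold by computation: the windows are closed under σz, and the word 0 is
  -- allowed.
  m0 refl (λ ()) tt tt

module B₄ = Avoidance σb headsB tailsB shapesB windowsB σb-nonerasing headsB-complete tailsB-complete recogniseB
  l0 refl (λ ()) tt tt

conjugate-squares : Formula 4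
conjugate-squares = (A ∷ C ∷ A ∷ C ∷ []) ∷ (C ∷ A ∷ C ∷ A ∷ []) ∷ []

z₃-conjugate-squares : Z.Absent conjugate-squares
-- `refl` evaluates the search; 6 is a sufficient bound on the nested desubstitutions.
z₃-conjugate-squares = Z.absent conjugate-squares [] 6 tt [] refl

-- Matching this order of the fragments is faster, because CDADC fixes the substitution early.
f₂-swapped : Formula 4
f₂-swapped = (C ∷ D ∷ A ∷ D ∷ C ∷ B ∷ A ∷ []) ∷ (A ∷ B ∷ C ∷ D ∷ A ∷ D ∷ C ∷ []) ∷ []

z₃-f₂-swapped : Z.Absent f₂-swapped
z₃-f₂-swapped = Z.absent f₂-swapped (conjugate-squares ∷ []) 6 tt (z₃-conjugate-squares ∷ []) refl

z₃-f₂ : Z.Absent f₂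
z₃-f₂ i (h , hs , p ∷ q ∷ []) = z₃-f₂-swapped i (h , hs , q ∷ p ∷ [])

z₃-f₃ : Z.Absent f₃
z₃-f₃ = Z.absent f₃ (conjugate-squares ∷ []) 6 tt (z₃-conjugate-squares ∷ []) refl

-- All are taken over four variables, so that they can be listed as excluded formulas in the
-- searches for f₁ and f₃.
square ABCA·ACBA ABCAB·BACBA ABACBA·ABCABA : Formula 4
square = (A ∷ A ∷ []) ∷ []
ABCA·ACBA = (A ∷ B ∷ C ∷ A ∷ []) ∷ (A ∷ C ∷ B ∷ A ∷ []) ∷ []
ABCAB·BACBA = (A ∷ B ∷ C ∷ A ∷ B ∷ []) ∷ (B ∷ A ∷ C ∷ B ∷ A ∷ []) ∷ []
ABACBA·ABCABA = (A ∷ B ∷ A ∷ C ∷ B ∷ A ∷ []) ∷ (A ∷ B ∷ C ∷ A ∷ B ∷ A ∷ []) ∷ []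

b₄-square : B₄.Absent square
b₄-square = B₄.absent square [] 6 tt [] refl

b₄-ABCA·ACBA : B₄.Absent ABCA·ACBA
b₄-ABCA·ACBA = B₄.absent ABCA·ACBA [] 6 tt [] refl

b₄-ABCAB·BACBA : B₄.Absent ABCAB·BACBA
b₄-ABCAB·BACBA = B₄.absent ABCAB·BACBA [] 6 tt [] refl

b₄-ABACBA·ABCABA : B₄.Absent ABACBA·ABCABA
b₄-ABACBA·ABCABA = B₄.absent ABACBA·ABCABA [] 6 tt [] refl

b₄-f₁ : B₄.Absent f₁
b₄-f₁ = B₄.absent f₁ (ABCA·ACBA ∷ []) 6 tt (b₄-ABCA·ACBA ∷ []) refl

b₄-f₃ : B₄.Absent f₃
b₄-f₃ = B₄.absent f₃ (ABCAB·BACBA ∷ ABACBA·ABCABA ∷ square ∷ []) 6 tt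
  (b₄-ABCAB·BACBA ∷ b₄-ABACBA·ABCABA ∷ b₄-square ∷ []) refl

theorem18 : Avoids b₄ f₁ × Avoids z₃ f₂ × (Avoids z₃ f₃ × Avoids b₄ f₃)
theorem18 = B₄.avoids f₁ tt b₄-f₁ , Z.avoids f₂ tt z₃-f₂ , (Z.avoids f₃ tt z₃-f₃ , B₄.avoids f₃ tt b₄-f₃)
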